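{- For each integer $k\ge 2$, let $R^{\mathrm{asym}}(k)$ (respectively $R^{\mathrm{abs}}(k)$) be the infimum, over all online algorithms for bin packing with cardinality constraint $k$, of the asymptotic (respectively absolute) competitive ratio. Then $\sup_{k\ge 2}R^{\mathrm{asym}}(k)=\sup_{k\ge2}R^{\mathrm{abs}}(k)=2$; that is, the overall asymptotic and absolute competitive ratios for online bin packing with cardinality constraints are both equal to $2$.
   Context: Bin packing with cardinality constraints (CCBP) with integer parameter $k\ge 2$: items with sizes in $(0,1]$ must be partitioned into bins so that each bin has total size at most $1$ and contains at most $k$ items. In the online version items arrive one by one and each must be irrevocably packed (into a new bin or a non-empty bin, respecting both constraints) before the next item arrives. For an input $L$, $A(L)$ denotes the number of bins used by algorithm $A$ and $OPT(L)$ the minimum possible number of bins. The absolute competitive ratio of $A$ is $\sup_L A(L)/OPT(L)$; the asymptotic competitive ratio is $\lim_{K\to\infty}\sup\{A(L)/OPT(L): OPT(L)\ge K\}$.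
   Formalization: The item sizes are rational numbers in (0,1] rather than arbitrary real numbers in (0,1]. -}

module Defs where

open import Data.Nat as ℕ using (ℕ; zero; suc; _<?_)
open import Data.Integer using (+_)
open import Data.Rational using (ℚ; 0ℚ; 1ℚ; _+_; _*_; _-_; _≤_; _<_; _/_)
open import Data.Rational.Properties using (_≤?_)
open import Data.List using (List; []; _∷_; _++_; [_]; length; concat; foldr)
open import Data.List.Relation.Unary.All using (All)
open import Data.List.Relation.Binary.Permutation.Propositional using (_↭_)
open import Data.Product using (Σ; ∃; ∃-syntax; _×_; _,_; proj₁)
open import Relation.Binary.PropositionalEquality using (_≡_)
open import Relation.Nullary using (yes; no)
open import Data.Maybe using (Maybe; just; nothing)
import Data.Maybe

ℕtoℚ : ℕ → ℚ
ℕtoℚ n = (+ n) / 1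

2ℚ : ℚ
2ℚ = ℕtoℚ 2

Item : Set
Item = Σ ℚ (λ s → (0ℚ < s) × (s ≤ 1ℚ))

size : Item → ℚ
size = proj₁

load : List Item → ℚ
load = foldr (λ x acc → size x + acc) 0ℚ

Packable : ℕ → List Item → ℕ → Set
Packable k L m =
  ∃[ bins ] (length bins ≡ m) × (concat bins ↭ L)
            × All (λ b → (load b ≤ 1ℚ) × (length b ℕ.≤ k)) bins

IsOpt : ℕ → List Item → ℕ → Set
IsOpt k L m = Packable k L m × (∀ m′ → Packable k L m′ → m ℕ.≤ m′)

-- A deterministic online algorithm: given the history of previously
-- arrived items (in arrival order) and the current item, it names the
-- index of an existing bin (bins are numbered in opening order) to put
-- the item in; any index that is out of range or whose bin cannot
-- accept the item (load or cardinality) means "open a new bin".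
-- Every deterministic online algorithm is represented this way, and
-- every such function is a legal online algorithm.
OnlineAlg : Set
OnlineAlg = List Item → Item → ℕ

-- a bin state: (current load, number of items)
BinState : Set
BinState = ℚ × ℕ

tryPlace : ℕ → List BinState → ℕ → ℚ → Maybe (List BinState)
tryPlace k []             i       s = nothing
tryPlace k ((l , c) ∷ bs) zero    s with l + s ≤? 1ℚ | c <? k
... | yes _ | yes _ = just ((l + s , suc c) ∷ bs)
... | _     | _     = nothing
tryPlace k ((l , c) ∷ bs) (suc i) s = Data.Maybe.map ((l , c) ∷_) (tryPlace k bs i s)

place : ℕ → List BinState → ℕ → ℚ → List BinState
place k bs i s with tryPlace k bs i s
... | just bs′ = bs′
... | nothing  = bs ++ [ (s , 1) ]

runFrom : ℕ → OnlineAlg → List Item → List BinState → List Item → List BinState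
runFrom k A hist bs []       = bs
runFrom k A hist bs (x ∷ xs) = runFrom k A (hist ++ [ x ]) (place k bs (A hist x) (size x)) xs

binsUsed : ℕ → OnlineAlg → List Item → ℕ
binsUsed k A L = length (runFrom k A [] [] L)

-- Competitive-ratio bounds (ratios A(L)/OPT(L) are compared with a
-- rational c by cross-multiplication)

AbsRatioAtMost : ℕ → OnlineAlg → ℚ → Set
AbsRatioAtMost k A c =
  ∀ L m → IsOpt k L m → ℕtoℚ (binsUsed k A L) ≤ c * ℕtoℚ m

AsymRatioEventuallyAtMost : ℕ → OnlineAlg → ℚ → Set
AsymRatioEventuallyAtMost k A c =
  ∃[ K ] ∀ L m → IsOpt k L m → K ℕ.≤ m → ℕtoℚ (binsUsed k A L) ≤ c * ℕtoℚ m

AbsRatioExceeds : ℕ → OnlineAlg → ℚ → Set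
AbsRatioExceeds k A c =
  ∃[ L ] ∃[ m ] IsOpt k L m × 1 ℕ.≤ m × c * ℕtoℚ m < ℕtoℚ (binsUsed k A L)

AsymRatioExceeds : ℕ → OnlineAlg → ℚ → Set
AsymRatioExceeds k A c =
  ∀ K → ∃[ L ] ∃[ m ] IsOpt k L m × K ℕ.≤ m × 1 ℕ.≤ m
                      × c * ℕtoℚ m < ℕtoℚ (binsUsed k A L)

{-# OPTIONS --safe #-}
module Submission where

open import Defs
open import Data.Nat using (ℕ; _≤_)
open import Data.Rational using (ℚ; 0ℚ; _<_; _+_; _-_)
open import Data.Product using (_×_; ∃-syntax)

open import Data.Empty using (⊥)
import Data.Integer as ℤ
import Data.Integer.Properties as ℤ
open import Data.List
  using (List; []; _∷_; _++_; [_]; length; concat; foldr; foldl; map; replicate; take; drop)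
import Data.List.Properties as List
open import Data.List.Membership.Propositional using (_∈_)
open import Data.List.Relation.Binary.Permutation.Propositional
  using (_↭_; refl; prep; swap; ↭-sym; ↭-trans; ↭-refl; ↭-reflexive)
import Data.List.Relation.Binary.Permutation.Propositional.Properties as Perm
open import Data.List.Relation.Unary.All as All using (All; []; _∷_)
import Data.List.Relation.Unary.All.Properties as All
open import Data.List.Relation.Unary.AllPairs using (AllPairs; []; _∷_)
open import Data.List.Relation.Unary.Any as Any using (Any; here; there; any?)
open import Data.Maybe using (just; nothing)
open import Data.Nat as ℕ using (zero; suc; z≤n; s≤s)
import Data.Nat.DivMod as ℕ
open import Data.Nat.ListAction using (sum)
open import Data.Nat.ListAction.Properties using (sum-++; sum-↭)
import Data.Nat.Properties as ℕ
import Data.Nat.Solver as ℕSolver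
open import Data.Product using (_,_; proj₁; proj₂)
open import Data.Rational as ℚ using (1ℚ; -_)
import Data.Rational.Properties as ℚ
import Data.Rational.Solver as ℚSolver
import Data.Rational.Unnormalised as ℚᵘ
import Data.Rational.Unnormalised.Properties as ℚᵘ
open import Data.Sum as Sum using (_⊎_; inj₁; inj₂)
open import Data.Unit using (⊤; tt)
open import Function using (id)
open import Relation.Binary.PropositionalEquality
  using (_≡_; refl; sym; trans; cong; cong₂; subst; subst₂; module ≡-Reasoning)
open import Relation.Nullary using (Dec; yes; no; ¬_; contradiction)
open import Relation.Nullary.Decidable using (_×-dec_)

-- Upper bound.  The algorithm fills bins in First Fit fashion, but only up to
-- k − 1 items; an item that fits in no such open bin becomes the k-th item of a
-- bin with k − 1 items, if one has room, and that bin is then closed together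
-- with an open one.  The closed pair has load > 1 and at least k items, so it
-- pays for two bins in both lower bounds on OPT.  Among the unclosed bins, the
-- ones opened while another bin was open ("good") have load > 1 together with
-- any other unclosed bin, and all the others ("plain") but one have k − 1
-- items.  If plain bins outnumber good ones by at least two, counting items
-- gives A ≤ 2 OPT; otherwise pairing plain with good bins bounds the load.
--
-- Lower bound.  Present k T tiny items, T = k j, choosing sizes adaptively so
-- that each item that opens a bin is at least k times larger than each item
-- that does not.  If 2T bins are open then OPT = T and we stop.  Otherwise send
-- T items that fit with k − 1 of the smaller tiny items but with none of the
-- larger ones.  Each needs a new bin, while OPT puts the few larger tiny items
-- aside, k to a bin, and needs at most T + 2j bins.

-- Rational inequalities and the embedding of the naturals.

p≤q⇒0≤q-p : ∀ {p q} → p ℚ.≤ q → 0ℚ ℚ.≤ q - p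
p≤q⇒0≤q-p {p} {q} p≤q = subst (ℚ._≤ q - p) (ℚ.+-inverseʳ p) (ℚ.+-monoˡ-≤ (- p) p≤q)

p<q⇒0<q-p : ∀ {p q} → p < q → 0ℚ < q - p
p<q⇒0<q-p {p} {q} p<q = subst (_< q - p) (ℚ.+-inverseʳ p) (ℚ.+-monoˡ-< (- p) p<q)

module _ where
  open ℚSolver.+-*-Solver

  p+[q-p]≡q : ∀ p q → p + (q - p) ≡ q
  p+[q-p]≡q = solve 2 (λ p q → p :+ (q :- p) := q) refl

-- The difference is a separate term `d` so that linear inequalities can be proved by certificate:
-- `d` is a sum of slacks known to be nonnegative, and the ring solver checks that it equals the
-- difference.
0≤q-p⇒p≤q : ∀ {p q d} → 0ℚ ℚ.≤ d → q - p ≡ d → p ℚ.≤ q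
0≤q-p⇒p≤q {p} {q} 0≤d refl =
  subst₂ ℚ._≤_ (ℚ.+-identityʳ p) (p+[q-p]≡q p q) (ℚ.+-monoʳ-≤ p 0≤d)

0<q-p⇒p<q : ∀ {p q d} → 0ℚ < d → q - p ≡ d → p < q
0<q-p⇒p<q {p} {q} 0<d refl =
  subst₂ _<_ (ℚ.+-identityʳ p) (p+[q-p]≡q p q) (ℚ.+-monoʳ-< p 0<d)

0≤p+q : ∀ {p q} → 0ℚ ℚ.≤ p → 0ℚ ℚ.≤ q → 0ℚ ℚ.≤ p + q
0≤p+q = ℚ.+-mono-≤

0<p+q : ∀ {p q} → 0ℚ < p → 0ℚ ℚ.≤ q → 0ℚ < p + q
0<p+q = ℚ.+-mono-<-≤

-- The quotient in `ℕtoℚ` is normalised by a gcd, which does not compute on variables, so the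
-- equation is checked on unnormalised fractions with denominator 1.
ℕtoℚ-homo-+ : ∀ m n → ℕtoℚ (m ℕ.+ n) ≡ ℕtoℚ m + ℕtoℚ n
ℕtoℚ-homo-+ m n = ℚ.toℚᵘ-injective (begin-equality
  ℚ.toℚᵘ (ℕtoℚ (m ℕ.+ n))                 ≃⟨ ℚ.toℚᵘ-fromℚᵘ (ℚᵘ.mkℚᵘ (ℤ.+ (m ℕ.+ n)) 0) ⟩
  ℚᵘ.mkℚᵘ (ℤ.+ (m ℕ.+ n)) 0                 ≃⟨ ℚᵘ.*≡* (cong (ℤ._* ℤ.+ 1) (cong₂ ℤ._+_ (sym (ℤ.*-identityʳ (ℤ.+ m))) (sym (ℤ.*-identityʳ (ℤ.+ n))))) ⟩
  ℚᵘ.mkℚᵘ (ℤ.+ m) 0 ℚᵘ.+ ℚᵘ.mkℚᵘ (ℤ.+ n) 0    ≃⟨ ℚᵘ.+-cong (ℚ.toℚᵘ-fromℚᵘ (ℚᵘ.mkℚᵘ (ℤ.+ m) 0)) (ℚ.toℚᵘ-fromℚᵘ (ℚᵘ.mkℚᵘ (ℤ.+ n) 0)) ⟨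
  ℚ.toℚᵘ (ℕtoℚ m) ℚᵘ.+ ℚ.toℚᵘ (ℕtoℚ n)    ≃⟨ ℚ.toℚᵘ-homo-+ (ℕtoℚ m) (ℕtoℚ n) ⟨
  ℚ.toℚᵘ (ℕtoℚ m + ℕtoℚ n)                ∎)
  where open ℚᵘ.≤-Reasoning

0≤ℕtoℚ : ∀ n → 0ℚ ℚ.≤ ℕtoℚ n
0≤ℕtoℚ zero    = ℚ.≤-refl
0≤ℕtoℚ (suc n) = subst (0ℚ ℚ.≤_) (sym (ℕtoℚ-homo-+ 1 n)) (0≤p+q {1ℚ} (ℚ.nonNegative⁻¹ 1ℚ) (0≤ℕtoℚ n))

ℕtoℚ-mono-≤ : ∀ {m n} → m ≤ n → ℕtoℚ m ℚ.≤ ℕtoℚ n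
ℕtoℚ-mono-≤ {m} {n} m≤n = subst₂ ℚ._≤_ (ℚ.+-identityʳ (ℕtoℚ m))
  (trans (sym (ℕtoℚ-homo-+ m (n ℕ.∸ m))) (cong ℕtoℚ (ℕ.m+[n∸m]≡n m≤n)))
  (ℚ.+-monoʳ-≤ (ℕtoℚ m) (0≤ℕtoℚ (n ℕ.∸ m)))

ℕtoℚ-cancel-< : ∀ {m n} → ℕtoℚ m < ℕtoℚ n → m ℕ.< n
ℕtoℚ-cancel-< m<n = ℕ.≰⇒> (λ n≤m → ℚ.<-irrefl refl (ℚ.<-≤-trans m<n (ℕtoℚ-mono-≤ n≤m)))

ℕtoℚ-homo-* : ∀ m n → ℕtoℚ (m ℕ.* n) ≡ ℕtoℚ m ℚ.* ℕtoℚ n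
ℕtoℚ-homo-* zero    n = sym (ℚ.*-zeroˡ (ℕtoℚ n))
ℕtoℚ-homo-* (suc m) n = begin
  ℕtoℚ (n ℕ.+ m ℕ.* n)                ≡⟨ ℕtoℚ-homo-+ n (m ℕ.* n) ⟩
  ℕtoℚ n + ℕtoℚ (m ℕ.* n)             ≡⟨ cong (ℕtoℚ n +_) (ℕtoℚ-homo-* m n) ⟩
  ℕtoℚ n + ℕtoℚ m ℚ.* ℕtoℚ n          ≡⟨ cong (_+ ℕtoℚ m ℚ.* ℕtoℚ n) (ℚ.*-identityˡ (ℕtoℚ n)) ⟨
  1ℚ ℚ.* ℕtoℚ n + ℕtoℚ m ℚ.* ℕtoℚ n   ≡⟨ ℚ.*-distribʳ-+ (ℕtoℚ n) 1ℚ (ℕtoℚ m) ⟨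
  (1ℚ + ℕtoℚ m) ℚ.* ℕtoℚ n            ≡⟨ cong (ℚ._* ℕtoℚ n) (ℕtoℚ-homo-+ 1 m) ⟨
  ℕtoℚ (suc m) ℚ.* ℕtoℚ n             ∎
  where open ≡-Reasoning

-- Sums over lists.

module _ {A : Set} (f : A → ℚ) where

  total : List A → ℚ
  total = foldr (λ x acc → f x + acc) 0ℚ

  total-++ : ∀ xs ys → total (xs ++ ys) ≡ total xs + total ys
  total-++ []       ys = sym (ℚ.+-identityˡ (total ys))
  total-++ (x ∷ xs) ys =
    trans (cong (_+_ (f x)) (total-++ xs ys)) (sym (ℚ.+-assoc (f x) (total xs) (total ys)))

  total-↭ : ∀ {xs ys} → xs ↭ ys → total xs ≡ total ys
  total-↭ refl            = refl
  total-↭ (prep x p)      = cong (_+_ (f x)) (total-↭ p)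
  total-↭ (_↭_.trans p q) = trans (total-↭ p) (total-↭ q)
  total-↭ (swap {xs} {ys} x y p) = begin
    f x + (f y + total xs)   ≡⟨ ℚ.+-assoc (f x) (f y) (total xs) ⟨
    f x + f y + total xs     ≡⟨ cong₂ _+_ (ℚ.+-comm (f x) (f y)) (total-↭ p) ⟩
    f y + f x + total ys     ≡⟨ ℚ.+-assoc (f y) (f x) (total ys) ⟩
    f y + (f x + total ys)   ∎
    where open ≡-Reasoning

  total-≤ : ∀ {c xs} → All (λ x → f x ℚ.≤ c) xs → total xs ℚ.≤ ℕtoℚ (length xs) ℚ.* c
  total-≤ {c} []                    = ℚ.≤-reflexive (sym (ℚ.*-zeroˡ c))
  total-≤ {c} {x ∷ xs} (fx≤c ∷ all) = subst (total (x ∷ xs) ℚ.≤_) eq (ℚ.+-mono-≤ fx≤c (total-≤ all))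
    where
    open ≡-Reasoning
    eq : c + ℕtoℚ (length xs) ℚ.* c ≡ ℕtoℚ (suc (length xs)) ℚ.* c
    eq = begin
      c + ℕtoℚ (length xs) ℚ.* c          ≡⟨ cong (_+ ℕtoℚ (length xs) ℚ.* c) (ℚ.*-identityˡ c) ⟨
      1ℚ ℚ.* c + ℕtoℚ (length xs) ℚ.* c   ≡⟨ ℚ.*-distribʳ-+ c 1ℚ (ℕtoℚ (length xs)) ⟨
      (1ℚ + ℕtoℚ (length xs)) ℚ.* c       ≡⟨ cong (ℚ._* c) (ℕtoℚ-homo-+ 1 (length xs)) ⟨
      ℕtoℚ (suc (length xs)) ℚ.* c        ∎

module _ {A : Set} (f : A → ℕ) where

  sumOf : List A → ℕ
  sumOf xs = sum (map f xs)

  sumOf-++ : ∀ xs ys → sumOf (xs ++ ys) ≡ sumOf xs ℕ.+ sumOf ys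
  sumOf-++ xs ys = trans (cong sum (List.map-++ f xs ys)) (sum-++ (map f xs) (map f ys))

  sumOf-↭ : ∀ {xs ys} → xs ↭ ys → sumOf xs ≡ sumOf ys
  sumOf-↭ p = sum-↭ (Perm.map⁺ f p)

  sumOf-≤ : ∀ {c xs} → All (λ x → f x ≤ c) xs → sumOf xs ≤ length xs ℕ.* c
  sumOf-≤ []           = z≤n
  sumOf-≤ (fx≤c ∷ all) = ℕ.+-mono-≤ fx≤c (sumOf-≤ all)

  sumOf-concat-≤ : ∀ {c xss} → All (λ xs → sumOf xs ≤ c) xss → sumOf (concat xss) ≤ length xss ℕ.* c
  sumOf-concat-≤ {xss = []}       []          = z≤n
  sumOf-concat-≤ {c} {xs ∷ xss} (xs≤c ∷ all) =
    subst (_≤ c ℕ.+ length xss ℕ.* c) (sym (sumOf-++ xs (concat xss)))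
      (ℕ.+-mono-≤ xs≤c (sumOf-concat-≤ all))

-- Lower bounds on the optimum.

load-concat-≤ : ∀ {bs} → All (λ b → load b ℚ.≤ 1ℚ) bs → load (concat bs) ℚ.≤ ℕtoℚ (length bs)
load-concat-≤ {[]}     []          = ℚ.≤-refl
load-concat-≤ {b ∷ bs} (b≤1 ∷ all) =
  subst₂ ℚ._≤_ (sym (total-++ size b (concat bs))) (sym (ℕtoℚ-homo-+ 1 (length bs)))
    (ℚ.+-mono-≤ b≤1 (load-concat-≤ all))

Packable-load : ∀ {k L m} → Packable k L m → load L ℚ.≤ ℕtoℚ m
Packable-load (bins , refl , perm , ok) =
  subst (ℚ._≤ _) (total-↭ size perm) (load-concat-≤ (All.map proj₁ ok))

-- The common form of the counting bounds. The constant weight 1 counts items; a finer weight later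
-- certifies the optimum of the adversary's input. Taking `k` as the capacity keeps the weights
-- natural.
Packable-weight : ∀ {k L m} (w : Item → ℕ) →
  (∀ b → load b ℚ.≤ 1ℚ → length b ≤ k → sumOf w b ≤ k) →
  Packable k L m → sumOf w L ≤ m ℕ.* k
Packable-weight w bin≤ (bins , refl , perm , ok) =
  subst (_≤ _) (sumOf-↭ w perm)
    (sumOf-concat-≤ w (All.map (λ { {b} (l , c) → bin≤ b l c }) ok))

sumOf-1 : ∀ {A : Set} (xs : List A) → sumOf (λ _ → 1) xs ≡ length xs
sumOf-1 []       = refl
sumOf-1 (x ∷ xs) = cong suc (sumOf-1 xs)

Packable-length : ∀ {k L m} → Packable k L m → length L ≤ m ℕ.* k
Packable-length {L = L} P = subst (_≤ _) (sumOf-1 L)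
  (Packable-weight (λ _ → 1) (λ b _ b≤k → subst (_≤ _) (sym (sumOf-1 b)) b≤k) P)

-- The effect of a single placement.

-- Forgets the index that an algorithm names and keeps only the outcome, so that later arguments
-- split into two cases: some bin grew legally, or a bin was opened.
data Placed (k : ℕ) (bs : List BinState) (s : ℚ) : List BinState → Set where
  added  : ∀ pre l c post → bs ≡ pre ++ (l , c) ∷ post → l + s ℚ.≤ 1ℚ → c ℕ.< k →
           Placed k bs s (pre ++ (l + s , suc c) ∷ post)
  opened : Placed k bs s (bs ++ [ (s , 1) ])

tryPlace-just : ∀ k bs i s {bs′} → tryPlace k bs i s ≡ just bs′ → Placed k bs s bs′
tryPlace-just k ((l , c) ∷ bs) zero s eq with l + s ℚ.≤? 1ℚ | c ℕ.<? k
tryPlace-just k ((l , c) ∷ bs) zero s refl | yes l+s≤1 | yes c<k = added [] l c bs refl l+s≤1 c<k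
tryPlace-just k ((l , c) ∷ bs) (suc i) s eq with tryPlace k bs i s in eq′
tryPlace-just k (b ∷ bs) (suc i) s refl | just bs′ with tryPlace-just k bs i s eq′
... | added pre l c post refl l+s≤1 c<k = added (b ∷ pre) l c post refl l+s≤1 c<k
... | opened = opened

placed : ∀ k bs i s → Placed k bs s (place k bs i s)
placed k bs i s with tryPlace k bs i s in eq
... | just bs′ = tryPlace-just k bs i s eq
... | nothing  = opened

total-place : ∀ {k bs s bs′} → Placed k bs s bs′ → total proj₁ bs′ ≡ total proj₁ bs + s
total-place {bs = bs} {s} opened = trans (total-++ proj₁ bs [ (s , 1) ]) (cong (_+_ (total proj₁ bs)) (ℚ.+-identityʳ s))
total-place {s = s} (added pre l c post refl _ _)
  rewrite total-++ proj₁ pre ((l + s , suc c) ∷ post) | total-++ proj₁ pre ((l , c) ∷ post)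
  = solve 4 (λ p l s q → p :+ ((l :+ s) :+ q) := (p :+ (l :+ q)) :+ s) refl (total proj₁ pre) l s (total proj₁ post)
  where open ℚSolver.+-*-Solver

sumOf-place : ∀ {k bs s bs′} → Placed k bs s bs′ → sumOf proj₂ bs′ ≡ suc (sumOf proj₂ bs)
sumOf-place {bs = bs} {s} opened = trans (sumOf-++ proj₂ bs [ (s , 1) ]) (ℕ.+-comm (sumOf proj₂ bs) 1)
sumOf-place {s = s} (added pre l c post refl _ _)
  rewrite sumOf-++ proj₂ pre ((l + s , suc c) ∷ post) | sumOf-++ proj₂ pre ((l , c) ∷ post)
  = ℕ.+-suc (sumOf proj₂ pre) (c ℕ.+ sumOf proj₂ post)

total-runFrom : ∀ k A hist bs xs → total proj₁ (runFrom k A hist bs xs) ≡ total proj₁ bs + load xs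
total-runFrom k A hist bs []       = sym (ℚ.+-identityʳ _)
total-runFrom k A hist bs (x ∷ xs) =
  trans (total-runFrom k A (hist ++ [ x ]) _ xs)
    (trans (cong (_+ load xs) (total-place (placed k bs (A hist x) (size x))))
           (ℚ.+-assoc (total proj₁ bs) (size x) (load xs)))

sumOf-runFrom : ∀ k A hist bs xs → sumOf proj₂ (runFrom k A hist bs xs) ≡ sumOf proj₂ bs ℕ.+ length xs
sumOf-runFrom k A hist bs []       = sym (ℕ.+-identityʳ _)
sumOf-runFrom k A hist bs (x ∷ xs) =
  trans (sumOf-runFrom k A (hist ++ [ x ]) _ xs)
    (trans (cong (ℕ._+ length xs) (sumOf-place (placed k bs (A hist x) (size x))))
           (sym (ℕ.+-suc (sumOf proj₂ bs) (length xs))))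

-- The algorithm and its tagged state.

data Tag : Set where
  plain good closed : Tag

record TBin : Set where
  constructor bin
  field
    tag   : Tag
    level : ℚ
    count : ℕ
open TBin

module _ {A : Set} {P : A → Set} (f : A → A) where

  modify : ∀ {xs} → Any P xs → List A
  modify {x ∷ xs} (here _)  = f x ∷ xs
  modify {x ∷ xs} (there p) = x ∷ modify p

  position : ∀ {xs} → Any P xs → ℕ
  position (here _)  = 0
  position (there p) = suc (position p)

  -- Everything tracked about the state is invariant under permutation, so a change at any position
  -- can be studied at the head. With `f = id` this merely extracts an element satisfying `P`.
  modify-↭ : ∀ {xs} (p : Any P xs) →
    ∃[ x ] ∃[ ys ] P x × xs ↭ x ∷ ys × modify p ↭ f x ∷ ys
  modify-↭ {x ∷ xs} (here px) = x , xs , px , ↭-refl , ↭-refl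
  modify-↭ {x ∷ xs} (there p) with modify-↭ p
  ... | y , ys , py , xs↭ , mod↭ =
    y , x ∷ ys , py , ↭-trans (prep x xs↭) (swap x y ↭-refl)
                    , ↭-trans (prep x mod↭) (swap x (f y) ↭-refl)

AllPairs-resp-↭ : ∀ {A : Set} {R : A → A → Set} → (∀ {x y} → R x y → R y x) →
  ∀ {xs ys} → xs ↭ ys → AllPairs R xs → AllPairs R ys
AllPairs-resp-↭ sym′ refl            Rs                        = Rs
AllPairs-resp-↭ sym′ (prep x p)      (Rx ∷ Rs)                 = Perm.All-resp-↭ p Rx ∷ AllPairs-resp-↭ sym′ p Rs
AllPairs-resp-↭ sym′ (swap x y p)    ((Rxy ∷ Rx) ∷ Ry ∷ Rs)    =
  (sym′ Rxy ∷ Perm.All-resp-↭ p Ry) ∷ Perm.All-resp-↭ p Rx ∷ AllPairs-resp-↭ sym′ p Rs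
AllPairs-resp-↭ sym′ (_↭_.trans p q) Rs                        = AllPairs-resp-↭ sym′ q (AllPairs-resp-↭ sym′ p Rs)

-- κ is one less than the cardinality bound.
module FillAndTop (κ : ℕ) where

  Active : Tag → Set
  Active closed = ⊥
  Active _      = ⊤

  active? : ∀ t → Dec (Active t)
  active? plain  = yes tt
  active? good   = yes tt
  active? closed = no λ ()

  Open : TBin → Set
  Open b = Active (tag b) × count b ℕ.< κ

  open? : ∀ b → Dec (Open b)
  open? b = active? (tag b) ×-dec (count b ℕ.<? κ)

  Takes : ℚ → TBin → Set
  Takes s b = Open b × level b + s ℚ.≤ 1ℚ

  takes? : ∀ s b → Dec (Takes s b)
  takes? s b = open? b ×-dec (level b + s ℚ.≤? 1ℚ)

  ToppedBy : ℚ → TBin → Set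
  ToppedBy s b = (Active (tag b) × count b ≡ κ) × level b + s ℚ.≤ 1ℚ

  toppedBy? : ∀ s b → Dec (ToppedBy s b)
  toppedBy? s b = (active? (tag b) ×-dec (count b ℕ.≟ κ)) ×-dec (level b + s ℚ.≤? 1ℚ)

  -- A good bin that reaches `κ` items becomes plain. The condition on pairs of plain bins then
  -- holds for it by its count. Good bins thus stay open: when no bin is open, there is no good bin
  -- with which a fresh plain bin would need load above 1.
  retag : Tag → ℕ → Tag
  retag t c with κ ℕ.≤? c
  ... | yes _ = plain
  ... | no  _ = t

  extend : ℚ → TBin → TBin
  extend s (bin t l c) = bin (retag t (suc c)) (l + s) (suc c)

  topUp : ℚ → TBin → TBin
  topUp s (bin t l c) = bin closed (l + s) (suc c)

  close : TBin → TBin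
  close (bin t l c) = bin closed l c

  -- Only called when an open bin exists, so the second case is junk.
  closeOpen : List TBin → List TBin
  closeOpen st with any? open? st
  ... | yes q = modify close q
  ... | no  _ = st

  -- A full bin is topped only while some bin is open, because that open bin is the partner to be
  -- closed with it. The index `length st` is out of range and therefore opens a new bin.
  move : List TBin → ℚ → ℕ × List TBin
  move st s with any? (takes? s) st
  ... | yes p = position (extend s) p , modify (extend s) p
  ... | no  _ with any? open? st
  ...   | no  _ = length st , st ++ [ bin plain s 1 ]
  ...   | yes _ with any? (toppedBy? s) st
  ...     | yes w = position (topUp s) w , closeOpen (modify (topUp s) w)
  ...     | no  _ = length st , st ++ [ bin good s 1 ]

  -- Agreement of the tagged state with the online model.

  forget : TBin → BinState
  forget (bin _ l c) = l , c

  tryPlace-position : ∀ s {P} (f : TBin → TBin) → (∀ b → forget (f b) ≡ (level b + s , suc (count b))) →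
    (∀ b → P b → level b + s ℚ.≤ 1ℚ × count b ℕ.< suc κ) → ∀ {st} (p : Any P st) →
    tryPlace (suc κ) (map forget st) (position f p) s ≡ just (map forget (modify f p))
  tryPlace-position s f f≡ ok {bin t l c ∷ st} (here pb) with l + s ℚ.≤? 1ℚ | c ℕ.<? suc κ
  ... | yes _ | yes _  = cong (λ z → just (z ∷ map forget st)) (sym (f≡ (bin t l c)))
  ... | no ¬a | _      = contradiction (proj₁ (ok _ pb)) ¬a
  ... | yes _ | no ¬b  = contradiction (proj₂ (ok _ pb)) ¬b
  tryPlace-position s f f≡ ok {b ∷ st} (there p)
    rewrite tryPlace-position s f f≡ ok p = refl

  tryPlace-length : ∀ k s bs → tryPlace k bs (length bs) s ≡ nothing
  tryPlace-length k s []       = refl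
  tryPlace-length k s (b ∷ bs) rewrite tryPlace-length k s bs = refl

  forget-modify-close : ∀ {P : TBin → Set} {st} (p : Any P st) → map forget (modify close p) ≡ map forget st
  forget-modify-close (here _)  = refl
  forget-modify-close (there p) = cong (_ ∷_) (forget-modify-close p)

  forget-closeOpen : ∀ st → map forget (closeOpen st) ≡ map forget st
  forget-closeOpen st with any? open? st
  ... | yes q = forget-modify-close q
  ... | no  _ = refl

  place-just : ∀ k bs i s {bs′} → tryPlace k bs i s ≡ just bs′ → place k bs i s ≡ bs′
  place-just k bs i s eq rewrite eq = refl

  place-new : ∀ t s st → place (suc κ) (map forget st) (length st) s ≡ map forget (st ++ [ bin t s 1 ])
  place-new t s st
    rewrite sym (List.length-map forget st) | tryPlace-length (suc κ) s (map forget st)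
    = sym (List.map-++ forget st [ bin t s 1 ])

  -- An index naming an existing bin is always accepted: both tests include the load condition, and
  -- the counts tested, below or equal to `κ`, leave room under the bound `suc κ`. Closing a partner
  -- changes tags only.
  place-move : ∀ st s → place (suc κ) (map forget st) (proj₁ (move st s)) s ≡ map forget (proj₂ (move st s))
  place-move st s with any? (takes? s) st
  ... | yes p = place-just (suc κ) (map forget st) _ s (tryPlace-position s (extend s) (λ _ → refl)
                  (λ { _ ((_ , c<κ) , fits) → fits , ℕ.m<n⇒m<1+n c<κ }) p)
  ... | no  _ with any? open? st
  ...   | no  _ = place-new plain s st
  ...   | yes _ with any? (toppedBy? s) st
  ...     | yes w = trans (place-just (suc κ) (map forget st) _ s (tryPlace-position s (topUp s) (λ _ → refl)
                      (λ { _ ((_ , c≡κ) , fits) → fits , s≤s (ℕ.≤-reflexive c≡κ) }) w))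
                      (sym (forget-closeOpen _))
  ...     | no  _ = place-new good s st

  state : List Item → List TBin
  state = foldl (λ st x → proj₂ (move st (size x))) []

  -- The model hands over only the history, so the tags are recomputed from it at every arrival.
  algorithm : OnlineAlg
  algorithm hist x = proj₁ (move (state hist) (size x))

  state-∷ʳ : ∀ hist x → state (hist ++ [ x ]) ≡ proj₂ (move (state hist) (size x))
  state-∷ʳ hist x = List.foldl-++ _ [] hist [ x ]

  runFrom-state : ∀ hist xs →
    runFrom (suc κ) algorithm hist (map forget (state hist)) xs ≡ map forget (state (hist ++ xs))
  runFrom-state hist []       = cong (λ h → map forget (state h)) (sym (List.++-identityʳ hist))
  runFrom-state hist (x ∷ xs)
    rewrite place-move (state hist) (size x) | sym (state-∷ʳ hist x)
    = trans (runFrom-state (hist ++ [ x ]) xs) (cong (λ h → map forget (state h)) (List.++-assoc hist [ x ] xs))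

  binsUsed-state : ∀ L → binsUsed (suc κ) algorithm L ≡ length (state L)
  binsUsed-state L = trans (cong length (runFrom-state [] L)) (List.length-map forget (state L))

  -- The invariant and its preservation.

  -- The last clause, imposed on every pair, is a symmetric way to say that at most one plain bin
  -- has fewer than `κ` items.
  Compatible : TBin → TBin → Set
  Compatible b d = Active (tag b) → Active (tag d) →
    (tag b ≡ good ⊎ tag d ≡ good → 1ℚ < level b + level d) ×
    (tag b ≡ plain → tag d ≡ plain → κ ≤ count b ⊎ κ ≤ count d)

  Compatible-sym : ∀ {b d} → Compatible b d → Compatible d b
  Compatible-sym {b} {d} R act-d act-b with R act-b act-d
  ... | heavy , full = (λ g → subst (1ℚ <_) (ℚ.+-comm (level b) (level d)) (heavy (Sum.swap g)))
                     , (λ p q → Sum.swap (full q p))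

  retag-good : ∀ t c → retag t c ≡ good → t ≡ good × c ℕ.< κ
  retag-good t c eq with κ ℕ.≤? c
  retag-good t c () | yes _
  ... | no κ≰c = eq , ℕ.≰⇒> κ≰c

  retag-plain : ∀ t c → retag t c ≡ plain → κ ≤ c ⊎ t ≡ plain
  retag-plain t c eq with κ ℕ.≤? c
  ... | yes κ≤c = inj₁ κ≤c
  ... | no  _   = inj₂ eq

  retag-active : ∀ t c → Active t → Active (retag t c)
  retag-active t c act with κ ℕ.≤? c
  ... | yes _ = tt
  ... | no  _ = act

  -- Levels and counts only grow, and the only possible change of tag is to plain, which happens
  -- when the new count is at least `κ`.
  Compatible-extend : ∀ {s} b d → 0ℚ < s → Active (tag b) → Compatible b d → Compatible (extend s b) d
  Compatible-extend {s} (bin t l c) (bin t′ l′ c′) 0<s act R _ act′ with R act act′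
  ... | heavy , full = heavy′ , full′
    where
    heavy′ : retag t (suc c) ≡ good ⊎ t′ ≡ good → 1ℚ < l + s + l′
    heavy′ g = ℚ.<-trans (heavy (Sum.map₁ (λ eq → proj₁ (retag-good t (suc c) eq)) g))
      (ℚ.+-monoˡ-< l′ (subst (_< l + s) (ℚ.+-identityʳ l) (ℚ.+-monoʳ-< l 0<s)))
    full′ : retag t (suc c) ≡ plain → t′ ≡ plain → κ ≤ suc c ⊎ κ ≤ c′
    full′ eq eq′ with retag-plain t (suc c) eq
    ... | inj₁ κ≤c  = inj₁ κ≤c
    ... | inj₂ refl = Sum.map₁ ℕ.m≤n⇒m≤1+n (full refl eq′)

  Valid : TBin → Set
  Valid (bin t l c) = 0ℚ < l × 1 ≤ c × (Active t → c ≤ κ) × (t ≡ good → c ℕ.< κ)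

  -- Summed over bins this is twice the load minus the number of bins. `closedNeed` and `closedHave`
  -- play the same game with item counts, `k` per bin against twice the items, kept apart to avoid
  -- subtraction on naturals.
  excess : ℚ → ℚ
  excess l = l + l - 1ℚ

  closedExcess : TBin → ℚ
  closedExcess (bin closed l _) = excess l
  closedExcess _                = 0ℚ

  closedNeed : TBin → ℕ
  closedNeed (bin closed _ _) = suc κ
  closedNeed _                = 0

  closedHave : TBin → ℕ
  closedHave (bin closed _ c) = c ℕ.+ c
  closedHave _                = 0

  -- e and d are the surpluses that a closed bin lends to the partner closed right after it.
  record Invariant (e : ℚ) (d : ℕ) (st : List TBin) : Set where
    constructor inv
    field
      compatible   : AllPairs Compatible st
      valid        : All Valid st
      closedLoad   : e ℚ.≤ total closedExcess st
      closedCount  : d ℕ.+ sumOf closedNeed st ≤ sumOf closedHave st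
  open Invariant

  Invariant-↭ : ∀ {e d st st′} → st ↭ st′ → Invariant e d st → Invariant e d st′
  Invariant-↭ {e} {d} p (inv R V l c) = inv
    (AllPairs-resp-↭ (λ {b} {d} → Compatible-sym {b} {d}) p R)
    (Perm.All-resp-↭ p V)
    (subst (e ℚ.≤_) (total-↭ closedExcess p) l)
    (subst₂ (λ m n → d ℕ.+ m ≤ n) (sumOf-↭ closedNeed p) (sumOf-↭ closedHave p) c)

  closedExcess-active : ∀ b → Active (tag b) → closedExcess b ≡ 0ℚ
  closedExcess-active (bin plain _ _) _ = refl
  closedExcess-active (bin good _ _)  _ = refl

  closedNeed-active : ∀ b → Active (tag b) → closedNeed b ≡ 0
  closedNeed-active (bin plain _ _) _ = refl
  closedNeed-active (bin good _ _)  _ = refl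

  closedHave-active : ∀ b → Active (tag b) → closedHave b ≡ 0
  closedHave-active (bin plain _ _) _ = refl
  closedHave-active (bin good _ _)  _ = refl

  Invariant-active-∷ : ∀ {e d st} b → Active (tag b) → All (Compatible b) st → Valid b →
                       Invariant e d st → Invariant e d (b ∷ st)
  Invariant-active-∷ {e} {d} {st} b act Rb Vb (inv R V l c) = inv (Rb ∷ R) (Vb ∷ V)
    (subst (e ℚ.≤_) (trans (sym (ℚ.+-identityˡ _)) (cong (_+ total closedExcess st) (sym (closedExcess-active b act)))) l)
    (subst₂ (λ m n → d ℕ.+ (m ℕ.+ sumOf closedNeed st) ≤ n ℕ.+ sumOf closedHave st)
       (sym (closedNeed-active b act)) (sym (closedHave-active b act)) c)

  Invariant-active-tail : ∀ {e d st} b → Active (tag b) → Invariant e d (b ∷ st) → Invariant e d st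
  Invariant-active-tail {e} {d} {st} b act (inv (_ ∷ R) (_ ∷ V) l c) = inv R V
    (subst (e ℚ.≤_) (trans (cong (_+ total closedExcess st) (closedExcess-active b act)) (ℚ.+-identityˡ _)) l)
    (subst₂ (λ m n → d ℕ.+ (m ℕ.+ sumOf closedNeed st) ≤ n ℕ.+ sumOf closedHave st)
       (closedNeed-active b act) (closedHave-active b act) c)

  Invariant-extend : ∀ {s st} b → 0ℚ < s → Open b → Invariant 0ℚ 0 (b ∷ st) → Invariant 0ℚ 0 (extend s b ∷ st)
  Invariant-extend {s} b@(bin t l c) 0<s (act , c<κ) I@(inv (Rb ∷ _) ((0<l , 1≤c , _ , _) ∷ _) _ _) =
    Invariant-active-∷ (extend s b) (retag-active t (suc c) act)
      (All.map (λ {d} → Compatible-extend b d 0<s act) Rb)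
      (ℚ.+-mono-< 0<l 0<s , s≤s z≤n , (λ _ → c<κ) , (λ eq → proj₂ (retag-good t (suc c) eq)))
      (Invariant-active-tail b act I)

  -- The topped bin now has `k` items, which count `2k` against a need of `k`; the other `k` are
  -- lent. Its excess may be negative, so it is recorded as it is until the partner is closed.
  Invariant-topUp : ∀ {s st} b → 0ℚ < s → ToppedBy s b → Invariant 0ℚ 0 (b ∷ st) →
                    Invariant (excess (level b + s)) (suc κ) (topUp s b ∷ st)
  Invariant-topUp {s} {st} b@(bin t l c) 0<s ((act , refl) , _) I@(inv _ ((0<l , _) ∷ _) _ _)
    with Invariant-active-tail b act I
  ... | inv R V load≥ count≥ = inv (All.universal (λ _ ()) _ ∷ R)
    ((ℚ.+-mono-< 0<l 0<s , s≤s z≤n , (λ ()) , (λ ())) ∷ V)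
    (subst (ℚ._≤ excess (l + s) + total closedExcess st) (ℚ.+-identityʳ (excess (l + s)))
      (ℚ.+-monoʳ-≤ (excess (l + s)) load≥))
    (subst (_≤ (suc c ℕ.+ suc c) ℕ.+ sumOf closedHave st) (ℕ.+-assoc (suc c) (suc c) (sumOf closedNeed st))
      (ℕ.+-monoʳ-≤ (suc c ℕ.+ suc c) count≥))

  -- The partner rejected the item: its level `l′` satisfies `l′ + s > 1`. Hence the two excesses
  -- add up to `2 (l′ + s - 1) + 2 l > 0`. In the count, the loan `suc κ` is exactly the need of the
  -- partner.
  Invariant-close : ∀ {l s st} b → 0ℚ < l → Open b → 1ℚ < level b + s →
                    Invariant (excess (l + s)) (suc κ) (b ∷ st) → Invariant 0ℚ 0 (close b ∷ st)
  Invariant-close {l} {s} {st} b@(bin t l′ c) 0<l (act , _) 1<l′+s I@(inv _ ((0<l′ , 1≤c , _) ∷ _) _ _)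
    with Invariant-active-tail b act I
  ... | inv R V load≥ count≥ = inv (All.universal (λ _ ()) _ ∷ R)
    ((0<l′ , 1≤c , (λ ()) , (λ ())) ∷ V)
    (ℚ.≤-trans (ℚ.<⇒≤ both) (ℚ.+-monoʳ-≤ (excess l′) load≥))
    (ℕ.≤-trans count≥ (ℕ.m≤n+m _ (c ℕ.+ c)))
    where
    open ℚSolver.+-*-Solver
    slack = p<q⇒0<q-p 1<l′+s
    both : 0ℚ < excess l′ + excess (l + s)
    both = 0<q-p⇒p<q (0<p+q (ℚ.+-mono-< slack slack) (ℚ.<⇒≤ (ℚ.+-mono-< 0<l 0<l)))
      (solve 3 (λ l′ l s → (l′ :+ l′ :- con 1ℚ) :+ (l :+ s :+ (l :+ s) :- con 1ℚ) :- con 0ℚ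
                        := (l′ :+ s :- con 1ℚ) :+ (l′ :+ s :- con 1ℚ) :+ (l :+ l)) refl l′ l s)

  Invariant-closeOpen : ∀ {l s} st → 0ℚ < l → Any Open st → All (λ b → Open b → 1ℚ < level b + s) st →
    Invariant (excess (l + s)) (suc κ) st → Invariant 0ℚ 0 (closeOpen st)
  Invariant-closeOpen st 0<l o heavy I with any? open? st
  ... | no ¬o = contradiction o ¬o
  ... | yes q with modify-↭ close q
  ... | y , zs , open-y , st↭ , mod↭ =
    Invariant-↭ (↭-sym mod↭) (Invariant-close y 0<l open-y (All.head (Perm.All-resp-↭ st↭ heavy) open-y)
      (Invariant-↭ st↭ I))

  Invariant-move : 1 ≤ κ → ∀ st s → 0ℚ < s → Invariant 0ℚ 0 st → Invariant 0ℚ 0 (proj₂ (move st s))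
  Invariant-move 1≤κ st s 0<s I with any? (takes? s) st
  ... | yes p with modify-↭ (extend s) p
  ...   | b , ys , (open-b , _) , st↭ , mod↭ =
    Invariant-↭ (↭-sym mod↭) (Invariant-extend b 0<s open-b (Invariant-↭ st↭ I))
  Invariant-move 1≤κ st s 0<s I | no ¬takes with any? open? st
  ... | no ¬open = Invariant-↭ (Perm.∷↭∷ʳ _ st)
    (Invariant-active-∷ _ tt (All.tabulate compat) (0<s , s≤s z≤n , (λ _ → 1≤κ) , (λ ())) I)
    where
    compat : ∀ {b} → b ∈ st → Compatible (bin plain s 1) b
    compat b∈st _ act with All.lookup (valid I) b∈st | All.lookup (All.¬Any⇒All¬ st ¬open) b∈st
    ... | _ , _ , _ , good⇒ | ¬open-b =
      -- No bin is open, so a good bin is impossible and every unclosed bin has at least `κ` items.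
      (λ { (inj₂ eq) → contradiction (act , good⇒ eq) ¬open-b }) ,
      (λ _ _ → inj₂ (ℕ.≮⇒≥ (λ c<κ → ¬open-b (act , c<κ))))
  Invariant-move 1≤κ st s 0<s I | no ¬takes | yes o with any? (toppedBy? s) st
  ... | yes w with modify-↭ (topUp s) w
  ...   | bin t l c , ys , top@((act , refl) , _) , st↭ , mod↭ with Invariant-↭ st↭ I
  ...     | I′@(inv _ ((0<l , _) ∷ _) _ _) =
    Invariant-closeOpen _ 0<l
      -- The topped bin had `κ` items, so the open bin is a different one and is still there to be
      -- closed.
      (Perm.Any-resp-↭ (↭-sym mod↭) (there (Any.tail (λ (_ , c<c) → ℕ.<-irrefl refl c<c) (Perm.Any-resp-↭ st↭ o))))
      (Perm.All-resp-↭ (↭-sym mod↭) ((λ ()) ∷ All.tail (Perm.All-resp-↭ st↭ heavy)))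
      (Invariant-↭ (↭-sym mod↭) (Invariant-topUp _ 0<s top I′))
    where
    heavy : All (λ b → Open b → 1ℚ < level b + s) st
    heavy = All.map (λ ¬takes-b open-b → ℚ.≰⇒> (λ fits → ¬takes-b (open-b , fits))) (All.¬Any⇒All¬ st ¬takes)
  Invariant-move 1≤κ st s 0<s I | no ¬takes | yes o | no ¬top = Invariant-↭ (Perm.∷↭∷ʳ _ st)
    (Invariant-active-∷ _ tt (All.tabulate compat) (0<s , s≤s z≤n , (λ _ → 1≤κ) , (λ _ → 1<κ)) I)
    where
    -- The new good bin holds one item and must stay below `κ`; the existing open bin, nonempty and
    -- below `κ`, shows that this is so.
    1<κ : 1 ℕ.< κ
    1<κ with modify-↭ close o
    ... | b , ys , (_ , c<κ) , st↭ , _ with Perm.All-resp-↭ st↭ (valid I)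
    ...   | (_ , 1≤c , _) ∷ _ = ℕ.≤-<-trans 1≤c c<κ
    -- Bins below `κ` failed the first test and bins with `κ` items failed the top-up test, so the
    -- item fits in no unclosed bin.
    heavy : ∀ {b} → b ∈ st → Active (tag b) → 1ℚ < level b + s
    heavy {b} b∈st act with count b ℕ.<? κ
    ... | yes c<κ = ℚ.≰⇒> (λ fits → All.lookup (All.¬Any⇒All¬ st ¬takes) b∈st ((act , c<κ) , fits))
    ... | no c≮κ with All.lookup (valid I) b∈st
    ...   | _ , _ , c≤ , _ = ℚ.≰⇒> (λ fits → All.lookup (All.¬Any⇒All¬ st ¬top) b∈st
                               ((act , ℕ.≤-antisym (c≤ act) (ℕ.≮⇒≥ c≮κ)) , fits))
    compat : ∀ {b} → b ∈ st → Compatible (bin good s 1) b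
    compat {b} b∈st _ act = (λ _ → subst (1ℚ <_) (ℚ.+-comm (level b) s) (heavy b∈st act)) , (λ ())

  Invariant-foldl : 1 ≤ κ → ∀ st L → Invariant 0ℚ 0 st →
                    Invariant 0ℚ 0 (foldl (λ st x → proj₂ (move st (size x))) st L)
  Invariant-foldl 1≤κ st []                  I = I
  Invariant-foldl 1≤κ st ((s , 0<s , _) ∷ L) I = Invariant-foldl 1≤κ _ L (Invariant-move 1≤κ st s 0<s I)

  Invariant-state : 1 ≤ κ → ∀ L → Invariant 0ℚ 0 (state L)
  Invariant-state 1≤κ L = Invariant-foldl 1≤κ [] L (inv [] [] ℚ.≤-refl z≤n)

  -- Load and count accounting over the final state.

  plains : List TBin → List TBin
  plains []                       = []
  plains (b@(bin plain _ _) ∷ st) = b ∷ plains st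
  plains (_ ∷ st)                 = plains st

  goods : List TBin → List TBin
  goods []                        = []
  goods (b@(bin good _ _) ∷ st)   = b ∷ goods st
  goods (_ ∷ st)                  = goods st

  All-plains : ∀ {P : TBin → Set} {st} → All P st → All P (plains st)
  All-plains []                          = []
  All-plains {st = bin plain _ _ ∷ _}  (p ∷ ps) = p ∷ All-plains ps
  All-plains {st = bin good _ _ ∷ _}   (_ ∷ ps) = All-plains ps
  All-plains {st = bin closed _ _ ∷ _} (_ ∷ ps) = All-plains ps

  All-goods : ∀ {P : TBin → Set} {st} → All P st → All P (goods st)
  All-goods []                          = []
  All-goods {st = bin plain _ _ ∷ _}  (_ ∷ ps) = All-goods ps
  All-goods {st = bin good _ _ ∷ _}   (p ∷ ps) = p ∷ All-goods ps
  All-goods {st = bin closed _ _ ∷ _} (_ ∷ ps) = All-goods ps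

  tag-plains : ∀ st → All (λ b → tag b ≡ plain) (plains st)
  tag-plains []                    = []
  tag-plains (bin plain _ _ ∷ st)  = refl ∷ tag-plains st
  tag-plains (bin good _ _ ∷ st)   = tag-plains st
  tag-plains (bin closed _ _ ∷ st) = tag-plains st

  tag-goods : ∀ st → All (λ b → tag b ≡ good) (goods st)
  tag-goods []                    = []
  tag-goods (bin plain _ _ ∷ st)  = tag-goods st
  tag-goods (bin good _ _ ∷ st)   = refl ∷ tag-goods st
  tag-goods (bin closed _ _ ∷ st) = tag-goods st

  Heavy : TBin → TBin → Set
  Heavy b d = 1ℚ < level b + level d

  Full : TBin → TBin → Set
  Full b d = κ ≤ count b ⊎ κ ≤ count d

  plains-full : ∀ {st} → AllPairs Compatible st → AllPairs Full (plains st)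
  plains-full []                                 = []
  plains-full {bin plain _ _ ∷ st} (R ∷ Rs)      =
    All.zipWith (λ { (c , refl) → proj₂ (c tt tt) refl refl }) (All-plains R , tag-plains st) ∷ plains-full Rs
  plains-full {bin good _ _ ∷ st} (_ ∷ Rs)       = plains-full Rs
  plains-full {bin closed _ _ ∷ st} (_ ∷ Rs)     = plains-full Rs

  goods-heavy : ∀ {st} → AllPairs Compatible st → AllPairs Heavy (goods st)
  goods-heavy []                                 = []
  goods-heavy {bin plain _ _ ∷ st} (_ ∷ Rs)      = goods-heavy Rs
  goods-heavy {bin good _ _ ∷ st} (R ∷ Rs)       =
    All.zipWith (λ { (c , refl) → proj₁ (c tt tt) (inj₁ refl) }) (All-goods R , tag-goods st) ∷ goods-heavy Rs
  goods-heavy {bin closed _ _ ∷ st} (_ ∷ Rs)     = goods-heavy Rs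

  plains-goods-heavy : ∀ {st} → AllPairs Compatible st → All (λ p → All (Heavy p) (goods st)) (plains st)
  plains-goods-heavy []                              = []
  plains-goods-heavy {bin plain _ _ ∷ st} (R ∷ Rs)   =
    All.zipWith (λ { (c , refl) → proj₁ (c tt tt) (inj₂ refl) }) (All-goods R , tag-goods st) ∷ plains-goods-heavy Rs
  plains-goods-heavy {bin good l _ ∷ st} (R ∷ Rs)    =
    All.zipWith (λ { {bin _ l′ _} ((c , refl) , h) → subst (1ℚ <_) (ℚ.+-comm l l′) (proj₁ (c tt tt) (inj₁ refl)) ∷ h })
      (All.zip (All-plains R , tag-plains st) , plains-goods-heavy Rs)
  plains-goods-heavy {bin closed _ _ ∷ st} (_ ∷ Rs)  = plains-goods-heavy Rs

  binExcess : TBin → ℚ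
  binExcess b = excess (level b)

  total-split : ∀ st → total binExcess st ≡
                       total closedExcess st + (total binExcess (plains st) + total binExcess (goods st))
  total-split []       = refl
  total-split (bin plain l c ∷ st) = trans (cong (_+_ (excess l)) (total-split st))
    (solve 4 (λ e z p g → e :+ (z :+ (p :+ g)) := (con 0ℚ :+ z) :+ ((e :+ p) :+ g)) refl
      (excess l) (total closedExcess st) (total binExcess (plains st)) (total binExcess (goods st)))
    where open ℚSolver.+-*-Solver
  total-split (bin good l c ∷ st) = trans (cong (_+_ (excess l)) (total-split st))
    (solve 4 (λ e z p g → e :+ (z :+ (p :+ g)) := (con 0ℚ :+ z) :+ (p :+ (e :+ g))) refl
      (excess l) (total closedExcess st) (total binExcess (plains st)) (total binExcess (goods st)))
    where open ℚSolver.+-*-Solver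
  total-split (bin closed l c ∷ st) = trans (cong (_+_ (excess l)) (total-split st))
    (sym (ℚ.+-assoc (excess l) (total closedExcess st) _))

  sumOf-split : ∀ (f : TBin → ℕ) (g : TBin → ℕ) → (∀ l c → f (bin closed l c) ≡ g (bin closed l c)) →
    (∀ b → Active (tag b) → g b ≡ 0) → ∀ st →
    sumOf f st ≡ sumOf g st ℕ.+ (sumOf f (plains st) ℕ.+ sumOf f (goods st))
  sumOf-split f g f≡g g≡0 [] = refl
  sumOf-split f g f≡g g≡0 (b@(bin plain l c) ∷ st) rewrite g≡0 b tt = trans (cong (f b ℕ.+_) (sumOf-split f g f≡g g≡0 st))
    (solve 4 (λ e z p g → e :+ (z :+ (p :+ g)) := z :+ ((e :+ p) :+ g)) refl
      (f b) (sumOf g st) (sumOf f (plains st)) (sumOf f (goods st)))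
    where open ℕSolver.+-*-Solver
  sumOf-split f g f≡g g≡0 (b@(bin good l c) ∷ st) rewrite g≡0 b tt = trans (cong (f b ℕ.+_) (sumOf-split f g f≡g g≡0 st))
    (solve 4 (λ e z p g → e :+ (z :+ (p :+ g)) := z :+ (p :+ (e :+ g))) refl
      (f b) (sumOf g st) (sumOf f (plains st)) (sumOf f (goods st)))
    where open ℕSolver.+-*-Solver
  sumOf-split f g f≡g g≡0 (b@(bin closed l c) ∷ st) rewrite f≡g l c = trans (cong (g b ℕ.+_) (sumOf-split f g f≡g g≡0 st))
    (sym (ℕ.+-assoc (g b) (sumOf g st) _))

  excess-pair : ∀ {p q r} → 1ℚ < p + q → - 1ℚ < r → - 1ℚ < excess p + excess q + r
  excess-pair {p} {q} {r} 1<p+q -1<r = 0<q-p⇒p<q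
    (0<p+q (ℚ.+-mono-< slack slack) (ℚ.<⇒≤ (p<q⇒0<q-p -1<r)))
    (solve 3 (λ p q r → (p :+ p :- con 1ℚ) :+ (q :+ q :- con 1ℚ) :+ r :- con (- 1ℚ)
                     := (p :+ q :- con 1ℚ) :+ (p :+ q :- con 1ℚ) :+ (r :- con (- 1ℚ))) refl p q r)
    where
    open ℚSolver.+-*-Solver
    slack = p<q⇒0<q-p 1<p+q

  excess-single : ∀ {p} → 0ℚ < p → - 1ℚ < excess p
  excess-single {p} 0<p = 0<q-p⇒p<q (ℚ.+-mono-< 0<p 0<p)
    (solve 1 (λ p → p :+ p :- con 1ℚ :- con (- 1ℚ) := p :+ p) refl p)
    where open ℚSolver.+-*-Solver

  -1<0 : - 1ℚ < 0ℚ
  -1<0 = ℚ.negative⁻¹ (- 1ℚ)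

  -- Match plain bins with good ones, then the remaining good bins with each other. A matched pair
  -- has positive excess, and at most one bin is left over, whose excess is above -1.
  pairing : ∀ ps gs → All (λ p → All (Heavy p) gs) ps → AllPairs Heavy gs →
    All (λ b → 0ℚ < level b) ps → All (λ b → 0ℚ < level b) gs → length ps ≤ suc (length gs) →
    - 1ℚ < total binExcess ps + total binExcess gs
  pairing [] [] _ _ _ _ _ = -1<0
  pairing [] (g ∷ []) _ _ _ (0<g ∷ _) _ =
    subst (- 1ℚ <_) (solve 1 (λ x → x := con 0ℚ :+ (x :+ con 0ℚ)) refl (binExcess g)) (excess-single 0<g)
    where open ℚSolver.+-*-Solver
  pairing [] (g ∷ h ∷ gs) _ ((gh ∷ _) ∷ (_ ∷ Rs)) _ (_ ∷ _ ∷ 0<gs) _ =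
    subst (- 1ℚ <_) (solve 3 (λ x y z → x :+ y :+ (con 0ℚ :+ z) := con 0ℚ :+ (x :+ (y :+ z))) refl
                       (binExcess g) (binExcess h) (total binExcess gs))
      (excess-pair {level g} {level h} gh (pairing [] gs [] Rs [] 0<gs z≤n))
    where open ℚSolver.+-*-Solver
  pairing (p ∷ []) [] _ _ (0<p ∷ _) _ _ =
    subst (- 1ℚ <_) (solve 1 (λ x → x := x :+ con 0ℚ :+ con 0ℚ) refl (binExcess p)) (excess-single 0<p)
    where open ℚSolver.+-*-Solver
  pairing (p ∷ q ∷ ps) [] _ _ _ _ (s≤s ())
  pairing (p ∷ ps) (g ∷ gs) ((pg ∷ _) ∷ pgs) (_ ∷ Rs) (_ ∷ 0<ps) (_ ∷ 0<gs) (s≤s len) =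
    subst (- 1ℚ <_) (solve 4 (λ x y z w → x :+ y :+ (z :+ w) := (x :+ z) :+ (y :+ w)) refl
                       (binExcess p) (binExcess g) (total binExcess ps) (total binExcess gs))
      (excess-pair {level p} {level g} pg (pairing ps gs (All.map All.tail pgs) Rs 0<ps 0<gs len))
    where open ℚSolver.+-*-Solver

  -- All bins but one hold `κ` items and that one is nonempty, giving at least
  -- `(length ps - 1) * κ + 1` items; moving `κ` to the right avoids the subtraction and covers the
  -- empty list. At the first bin below `κ`, all later ones must be full.
  full-count : 1 ≤ κ → ∀ ps → AllPairs Full ps → All (λ b → 1 ≤ count b) ps →
               length ps ℕ.* κ ℕ.+ 1 ≤ sumOf count ps ℕ.+ κ
  full-count 1≤κ [] _ _ = 1≤κ
  full-count 1≤κ (p ∷ ps) (R ∷ Rs) (1≤p ∷ 1≤ps) with κ ℕ.≤? count p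
  ... | yes κ≤p = begin
    κ ℕ.+ length ps ℕ.* κ ℕ.+ 1         ≡⟨ ℕ.+-assoc κ (length ps ℕ.* κ) 1 ⟩
    κ ℕ.+ (length ps ℕ.* κ ℕ.+ 1)       ≤⟨ ℕ.+-mono-≤ κ≤p (full-count 1≤κ ps Rs 1≤ps) ⟩
    count p ℕ.+ (sumOf count ps ℕ.+ κ)  ≡⟨ ℕ.+-assoc (count p) (sumOf count ps) κ ⟨
    count p ℕ.+ sumOf count ps ℕ.+ κ    ∎
    where open ℕ.≤-Reasoning
  ... | no κ≰p = begin
    κ ℕ.+ length ps ℕ.* κ ℕ.+ 1         ≡⟨ trans (ℕ.+-comm (κ ℕ.+ length ps ℕ.* κ) 1) (cong suc (ℕ.+-comm κ (length ps ℕ.* κ))) ⟩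
    1 ℕ.+ length ps ℕ.* κ ℕ.+ κ         ≤⟨ ℕ.+-monoˡ-≤ κ (ℕ.+-mono-≤ 1≤p (κs (All.map (λ {b} → rest {b}) R))) ⟩
    count p ℕ.+ sumOf count ps ℕ.+ κ    ∎
    where
    open ℕ.≤-Reasoning
    rest : ∀ {b} → Full p b → κ ≤ count b
    rest (inj₁ κ≤p) = contradiction κ≤p κ≰p
    rest (inj₂ κ≤b) = κ≤b
    κs : ∀ {bs} → All (λ b → κ ≤ count b) bs → length bs ℕ.* κ ≤ sumOf count bs
    κs []          = z≤n
    κs (κ≤b ∷ all) = ℕ.+-mono-≤ κ≤b (κs all)

  binExcess-total : ∀ st → total binExcess st ≡ total level st + total level st - ℕtoℚ (length st)
  binExcess-total []       = refl
  binExcess-total (b ∷ st) = trans (cong (_+_ (binExcess b)) (binExcess-total st))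
    (trans (solve 3 (λ l t n → (l :+ l :- con 1ℚ) :+ (t :+ t :- n) := (l :+ t) :+ (l :+ t) :- (con 1ℚ :+ n)) refl
             (level b) (total level st) (ℕtoℚ (length st)))
           (cong (λ z → level b + total level st + (level b + total level st) - z) (sym (ℕtoℚ-homo-+ 1 (length st)))))
    where open ℚSolver.+-*-Solver

  doubleCount : TBin → ℕ
  doubleCount b = count b ℕ.+ count b

  sumOf-double : ∀ bs → sumOf doubleCount bs ≡ sumOf count bs ℕ.+ sumOf count bs
  sumOf-double []       = refl
  sumOf-double (b ∷ bs) = trans (cong (doubleCount b ℕ.+_) (sumOf-double bs))
    (solve 2 (λ c t → (c :+ c) :+ (t :+ t) := (c :+ t) :+ (c :+ t)) refl (count b) (sumOf count bs))
    where open ℕSolver.+-*-Solver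

  closedOne : TBin → ℕ
  closedOne (bin closed _ _) = 1
  closedOne _                = 0

  sumOf-closedNeed : ∀ st → sumOf closedNeed st ≡ sumOf closedOne st ℕ.* suc κ
  sumOf-closedNeed []                    = refl
  sumOf-closedNeed (bin plain _ _ ∷ st)  = sumOf-closedNeed st
  sumOf-closedNeed (bin good _ _ ∷ st)   = sumOf-closedNeed st
  sumOf-closedNeed (bin closed _ _ ∷ st) = cong (suc κ ℕ.+_) (sumOf-closedNeed st)

  length-split : ∀ st → length st ≡ sumOf closedOne st ℕ.+ (length (plains st) ℕ.+ length (goods st))
  length-split st = trans (sym (sumOf-1 st)) (trans
    (sumOf-split (λ _ → 1) closedOne (λ _ _ → refl)
       (λ { (bin plain _ _) _ → refl ; (bin good _ _) _ → refl }) st)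
    (cong₂ (λ x y → sumOf closedOne st ℕ.+ (x ℕ.+ y)) (sumOf-1 (plains st)) (sumOf-1 (goods st))))

  -- For total load `W` and `n` bins, the total excess `2 W - n` is above -1: closed bins contribute
  -- at least 0 and the others more than -1. So `n < 2 m + 1`, and integrality finishes.
  length-≤-load : ∀ {m st} → Invariant 0ℚ 0 st → length (plains st) ≤ suc (length (goods st)) →
    total level st ℚ.≤ ℕtoℚ m → length st ≤ m ℕ.+ m
  length-≤-load {m} {st} I few W≤m = ℕ.≤-pred (ℕtoℚ-cancel-< (0<q-p⇒p<q
    (0<p+q (p<q⇒0<q-p -1<excess) (0≤p+q slack slack))
    (trans (cong (_- ℕtoℚ (length st)) (trans (ℕtoℚ-homo-+ 1 (m ℕ.+ m)) (cong (_+_ 1ℚ) (ℕtoℚ-homo-+ m m))))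
      (solve 3 (λ w m n → con 1ℚ :+ (m :+ m) :- n :=
                   (w :+ w :- n) :- con (- 1ℚ) :+ ((m :- w) :+ (m :- w))) refl (total level st) (ℕtoℚ m) (ℕtoℚ (length st))))))
    where
    open ℚSolver.+-*-Solver
    slack = p≤q⇒0≤q-p W≤m
    positive : All (λ b → 0ℚ < level b) st
    positive = All.map proj₁ (valid I)
    active : - 1ℚ < total binExcess (plains st) + total binExcess (goods st)
    active = pairing (plains st) (goods st) (plains-goods-heavy (compatible I)) (goods-heavy (compatible I))
               (All-plains positive) (All-goods positive) few
    -1<excess : - 1ℚ < total level st + total level st - ℕtoℚ (length st)
    -1<excess = subst (- 1ℚ <_) (trans (sym (total-split st)) (binExcess-total st))
      (subst (_< total closedExcess st + (total binExcess (plains st) + total binExcess (goods st)))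
        (ℚ.+-identityˡ (- 1ℚ)) (ℚ.+-mono-≤-< (closedLoad I) active))

  private
    -- Both sides are the polynomial `lhs` plus a remainder, `d` on the left and `d * κ` on the
    -- right.
    many-plains : ∀ p g d → p ≡ suc (suc g) ℕ.+ d → 1 ≤ κ →
      (p ℕ.+ g) ℕ.* suc κ ℕ.+ (κ ℕ.+ κ) ≤ (p ℕ.* κ ℕ.+ 1) ℕ.+ (p ℕ.* κ ℕ.+ 1) ℕ.+ (g ℕ.+ g)
    many-plains p g d refl 1≤κ = subst₂ _≤_
      (solve 3 (λ κ g d → lhs κ g d :+ d := (con 2 :+ g :+ d :+ g) :* (con 1 :+ κ) :+ (κ :+ κ)) refl κ g d)
      (solve 3 (λ κ g d → lhs κ g d :+ d :* κ := (con 2 :+ g :+ d) :* κ :+ con 1 :+ ((con 2 :+ g :+ d) :* κ :+ con 1) :+ (g :+ g)) refl κ g d)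
      (ℕ.+-monoʳ-≤ _ (subst (_≤ d ℕ.* κ) (ℕ.*-identityʳ d) (ℕ.*-monoʳ-≤ d 1≤κ)))
      where
      open ℕSolver.+-*-Solver
      lhs : ∀ {n} → Polynomial n → Polynomial n → Polynomial n → Polynomial n
      lhs κ g d = con 2 :+ g :+ g :+ κ :* (con 4 :+ g :+ g :+ d)

  -- Charge `k` to each bin and pay with twice the items. Closed bins pay by the invariant; the
  -- surplus of at least two plain bins over the good ones lets the full plain bins cover the good
  -- ones, which may hold a single item.
  length-≤-count : ∀ {m st} → 1 ≤ κ → Invariant 0ℚ 0 st → suc (length (goods st)) ℕ.< length (plains st) →
    sumOf count st ≤ m ℕ.* suc κ → length st ≤ m ℕ.+ m
  length-≤-count {m} {st} 1≤κ I many n≤mk = ℕ.*-cancelʳ-≤ _ _ (suc κ) (begin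
    length st ℕ.* suc κ                                ≡⟨ cong (ℕ._* suc κ) (length-split st) ⟩
    (z ℕ.+ (p ℕ.+ g)) ℕ.* suc κ                        ≡⟨ ℕ.*-distribʳ-+ (suc κ) z (p ℕ.+ g) ⟩
    z ℕ.* suc κ ℕ.+ (p ℕ.+ g) ℕ.* suc κ                ≡⟨ cong (ℕ._+ (p ℕ.+ g) ℕ.* suc κ) (sumOf-closedNeed st) ⟨
    sumOf closedNeed st ℕ.+ (p ℕ.+ g) ℕ.* suc κ        ≤⟨ ℕ.+-mono-≤ (closedCount I) active ⟩
    sumOf closedHave st ℕ.+ (sumOf doubleCount (plains st) ℕ.+ sumOf doubleCount (goods st))
      ≡⟨ sumOf-split doubleCount closedHave (λ _ _ → refl) closedHave-active st ⟨
    sumOf doubleCount st                               ≡⟨ sumOf-double st ⟩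
    sumOf count st ℕ.+ sumOf count st                  ≤⟨ ℕ.+-mono-≤ n≤mk n≤mk ⟩
    m ℕ.* suc κ ℕ.+ m ℕ.* suc κ                        ≡⟨ ℕ.*-distribʳ-+ (suc κ) m m ⟨
    (m ℕ.+ m) ℕ.* suc κ                                ∎)
    where
    open ℕ.≤-Reasoning
    z = sumOf closedOne st
    p = length (plains st)
    g = length (goods st)
    nonempty : All (λ b → 1 ≤ count b) st
    nonempty = All.map (λ v → proj₁ (proj₂ v)) (valid I)
    ones : ∀ {bs} → All (λ b → 1 ≤ count b) bs → length bs ≤ sumOf count bs
    ones []          = z≤n
    ones (1≤b ∷ all) = ℕ.+-mono-≤ 1≤b (ones all)
    plains-≥ : p ℕ.* κ ℕ.+ 1 ≤ sumOf count (plains st) ℕ.+ κ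
    plains-≥ = full-count 1≤κ (plains st) (plains-full (compatible I)) (All-plains nonempty)
    goods-≥ : g ≤ sumOf count (goods st)
    goods-≥ = ones (All-goods nonempty)
    shuffle : ∀ x y κ → (x ℕ.+ κ) ℕ.+ (x ℕ.+ κ) ℕ.+ (y ℕ.+ y) ≡ ((x ℕ.+ x) ℕ.+ (y ℕ.+ y)) ℕ.+ (κ ℕ.+ κ)
    shuffle = solve 3 (λ x y κ → (x :+ κ) :+ (x :+ κ) :+ (y :+ y) := ((x :+ x) :+ (y :+ y)) :+ (κ :+ κ)) refl
      where open ℕSolver.+-*-Solver
    active : (p ℕ.+ g) ℕ.* suc κ ≤ sumOf doubleCount (plains st) ℕ.+ sumOf doubleCount (goods st)
    active = ℕ.+-cancelʳ-≤ (κ ℕ.+ κ) _ _ (begin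
      (p ℕ.+ g) ℕ.* suc κ ℕ.+ (κ ℕ.+ κ)
        ≤⟨ many-plains p g (p ℕ.∸ suc (suc g)) (sym (ℕ.m+[n∸m]≡n many)) 1≤κ ⟩
      (p ℕ.* κ ℕ.+ 1) ℕ.+ (p ℕ.* κ ℕ.+ 1) ℕ.+ (g ℕ.+ g)
        ≤⟨ ℕ.+-mono-≤ (ℕ.+-mono-≤ plains-≥ plains-≥) (ℕ.+-mono-≤ goods-≥ goods-≥) ⟩
      _ ≡⟨ shuffle (sumOf count (plains st)) (sumOf count (goods st)) κ ⟩
      _ ≡⟨ cong₂ (λ x y → x ℕ.+ y ℕ.+ (κ ℕ.+ κ)) (sumOf-double (plains st)) (sumOf-double (goods st)) ⟨
      _ ∎)

  length-≤ : ∀ {m st} → 1 ≤ κ → Invariant 0ℚ 0 st → total level st ℚ.≤ ℕtoℚ m →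
    sumOf count st ≤ m ℕ.* suc κ → length st ≤ m ℕ.+ m
  length-≤ {m} {st} 1≤κ I W≤m n≤mk with length (plains st) ℕ.≤? suc (length (goods st))
  ... | yes few = length-≤-load {m} I few W≤m
  ... | no many = length-≤-count {m} 1≤κ I (ℕ.≰⇒> many) n≤mk

  -- The upper bound 2.

  total-state : ∀ L → total level (state L) ≡ load L
  total-state L = trans (sym (List.foldr-map _ forget 0ℚ (state L)))
    (trans (cong (total proj₁) (sym (runFrom-state [] L)))
      (trans (total-runFrom (suc κ) algorithm [] [] L) (ℚ.+-identityˡ (load L))))

  sumOf-state : ∀ L → sumOf count (state L) ≡ length L
  sumOf-state L = trans (cong sum (List.map-∘ (state L)))
    (trans (cong (sumOf proj₂) (sym (runFrom-state [] L))) (sumOf-runFrom (suc κ) algorithm [] [] L))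

  binsUsed-≤ : 1 ≤ κ → ∀ L m → Packable (suc κ) L m → binsUsed (suc κ) algorithm L ≤ m ℕ.+ m
  binsUsed-≤ 1≤κ L m P = subst (_≤ m ℕ.+ m) (sym (binsUsed-state L))
    (length-≤ {m} 1≤κ (Invariant-state 1≤κ L)
      (subst (ℚ._≤ ℕtoℚ m) (sym (total-state L)) (Packable-load P))
      (subst (_≤ m ℕ.* suc κ) (sym (sumOf-state L)) (Packable-length P)))

absRatio≤2 : ∀ k → 2 ≤ k → ∀ ε → 0ℚ < ε → ∃[ A ] AbsRatioAtMost k A (2ℚ + ε)
absRatio≤2 (suc κ) (s≤s 1≤κ) ε 0<ε = FillAndTop.algorithm κ , λ L m (P , _) →
  ℚ.≤-trans (ℕtoℚ-mono-≤ (FillAndTop.binsUsed-≤ κ 1≤κ L m P))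
    (subst₂ ℚ._≤_ (ℚ.+-identityʳ _)
      (trans (cong (_+ ε ℚ.* ℕtoℚ m) (trans (cong (λ z → ℕtoℚ (m ℕ.+ z)) (sym (ℕ.+-identityʳ m))) (ℕtoℚ-homo-* 2 m)))
             (sym (ℚ.*-distribʳ-+ (ℕtoℚ m) 2ℚ ε)))
      (ℚ.+-monoʳ-≤ (ℕtoℚ (m ℕ.+ m)) (subst (ℚ._≤ ε ℚ.* ℕtoℚ m) (ℚ.*-zeroˡ (ℕtoℚ m))
        (ℚ.*-monoʳ-≤-nonNeg (ℕtoℚ m) {{ℚ.nonNegative (0≤ℕtoℚ m)}} (ℚ.<⇒≤ 0<ε)))))

-- Division, chunking and growth factors for the lower bound.

divide : ∀ p n → 0ℚ < p → 1 ≤ n → ∃[ q ] 0ℚ < q × q ℚ.* ℕtoℚ n ≡ p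
divide p n 0<p 1≤n = p ℚ.* ℚ.1/ d , 0<q , eq
  where
  d = ℕtoℚ n
  instance
    pos-d : ℚ.Positive d
    pos-d = ℚ.positive (ℚ.<-≤-trans (ℚ.positive⁻¹ 1ℚ) (ℕtoℚ-mono-≤ 1≤n))
    nonZero-d : ℚ.NonZero d
    nonZero-d = ℚ.pos⇒nonZero d
    pos-1/d : ℚ.Positive (ℚ.1/ d)
    pos-1/d = ℚ.1/pos⇒pos d
  0<q : 0ℚ < p ℚ.* ℚ.1/ d
  0<q = subst (_< p ℚ.* ℚ.1/ d) (ℚ.*-zeroˡ (ℚ.1/ d)) (ℚ.*-monoˡ-<-pos (ℚ.1/ d) 0<p)
  eq : p ℚ.* ℚ.1/ d ℚ.* d ≡ p
  eq = trans (ℚ.*-assoc p (ℚ.1/ d) d) (trans (cong (p ℚ.*_) (ℚ.*-inverseˡ d)) (ℚ.*-identityʳ p))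

-- The denominator of `ε` serves as witness, since the product is then the positive numerator.
archimedean : ∀ ε → 0ℚ < ε → ∃[ q ] 1 ≤ q × 1ℚ ℚ.≤ ε ℚ.* ℕtoℚ q
archimedean ε 0<ε with ℚ.positive 0<ε
archimedean ε@(ℚ.mkℚ ℤ.+[1+ n ] d-1 _) 0<ε | _ = suc d-1 , s≤s z≤n , ℚ.toℚᵘ-cancel-≤ (begin
  ℚᵘ.1ℚᵘ                                     ≤⟨ ℚᵘ.*≤* (ℤ.+≤+ le) ⟩
  ℚ.toℚᵘ ε ℚᵘ.* ℚᵘ.mkℚᵘ (ℤ.+ suc d-1) 0      ≃⟨ ℚᵘ.*-congˡ {ℚ.toℚᵘ ε} (ℚ.toℚᵘ-fromℚᵘ (ℚᵘ.mkℚᵘ (ℤ.+ suc d-1) 0)) ⟨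
  ℚ.toℚᵘ ε ℚᵘ.* ℚ.toℚᵘ (ℕtoℚ (suc d-1))      ≃⟨ ℚ.toℚᵘ-homo-* ε (ℕtoℚ (suc d-1)) ⟨
  ℚ.toℚᵘ (ε ℚ.* ℕtoℚ (suc d-1))              ∎)
  where
  open ℚᵘ.≤-Reasoning
  le : 1 ℕ.* (suc d-1 ℕ.* 1) ≤ suc n ℕ.* suc d-1 ℕ.* 1
  le = subst₂ _≤_ (sym (ℕ.*-identityˡ _)) (sym (ℕ.*-assoc (suc n) (suc d-1) 1)) (ℕ.m≤m+n (suc d-1 ℕ.* 1) (n ℕ.* (suc d-1 ℕ.* 1)))

-- Blocks may be empty, so the number of bins of a packing can be prescribed exactly.
chunk : ∀ {A : Set} {P : A → Set} c q (xs : List A) → length xs ≤ q ℕ.* c → All P xs →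
  ∃[ bins ] length bins ≡ q × concat bins ≡ xs × All (λ b → length b ≤ c × All P b) bins
chunk c zero    []       _  _  = [] , refl , refl , []
chunk c (suc q) xs len ps with chunk c q (drop c xs)
    (subst₂ _≤_ (sym (List.length-drop c xs)) (ℕ.m+n∸m≡n c (q ℕ.* c)) (ℕ.∸-monoˡ-≤ c len)) (All.drop⁺ c ps)
... | bins , refl , eq , ok =
  take c xs ∷ bins , refl , trans (cong (take c xs ++_) eq) (List.take++drop≡id c xs) ,
  (subst (_≤ c) (sym (List.length-take c xs)) (ℕ.m⊓n≤m c (length xs)) , All.take⁺ c ps) ∷ ok

-- A factor of gap k r between lo and hi leaves room for r more items; squaring
-- provides that room on whichever side of the next size the adversary continues.
gap : ℕ → ℕ → ℕ
gap k zero    = k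
gap k (suc r) = gap k r ℕ.* gap k r

1≤gap : ∀ {k} → 1 ≤ k → ∀ r → 1 ≤ gap k r
1≤gap 1≤k zero    = 1≤k
1≤gap 1≤k (suc r) = ℕ.*-mono-≤ (1≤gap 1≤k r) (1≤gap 1≤k r)

-- The adaptive sequence of tiny items.

module Adversary (k : ℕ) (A : OnlineAlg) (1≤k : 1 ≤ k) (u : ℚ) (u≤1 : u ℚ.≤ 1ℚ) where

  -- The outcome of `r` tiny items sent from state `bs`. Sizes are chosen between `lo` and `hi`;
  -- this interval shrinks to `lo′` and `hi′`, which separate the items that opened bins (`larges`)
  -- from the others (`smalls`) by a factor `k`. `run` admits any continuation, so that big items
  -- can follow.
  record Sand (r : ℕ) (hist : List Item) (bs : List BinState) (lo hi : ℚ) : Set where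
    field
      items smalls larges : List Item
      lo′ hi′     : ℚ
      bins        : List BinState
      items-≡     : length items ≡ r
      items-↭     : items ↭ smalls ++ larges
      items-≤     : All (λ x → size x ℚ.≤ u) items
      smalls-≤    : All (λ x → size x ℚ.≤ lo′) smalls
      larges-≥    : All (λ x → hi′ ℚ.≤ size x) larges
      lo≤         : lo ℚ.≤ lo′
      hi≥         : hi′ ℚ.≤ hi
      gap-≤       : lo′ ℚ.* ℕtoℚ k ℚ.≤ hi′
      bins-≥      : All (λ b → hi′ ℚ.≤ proj₁ b) bins
      bins-≤k     : All (λ b → proj₂ b ≤ k) bins
      bins-≡      : length bins ≡ length bs ℕ.+ length larges
      run         : ∀ ys → runFrom k A hist bs (items ++ ys) ≡ runFrom k A (hist ++ items) bins ys

  scale : ℚ → ℕ → ℚ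
  scale lo r = lo ℚ.* ℕtoℚ (gap k r)

  lo≤scale : ∀ {lo} r → 0ℚ < lo → lo ℚ.≤ scale lo r
  lo≤scale {lo} r 0<lo = subst (ℚ._≤ scale lo r) (ℚ.*-identityʳ lo)
    (ℚ.*-monoˡ-≤-nonNeg lo {{ℚ.nonNegative (ℚ.<⇒≤ 0<lo)}} (ℕtoℚ-mono-≤ (1≤gap 1≤k r)))

  scale-suc : ∀ lo r → scale lo (suc r) ≡ scale (scale lo r) r
  scale-suc lo r = trans (cong (lo ℚ.*_) (ℕtoℚ-homo-* (gap k r) (gap k r)))
    (sym (ℚ.*-assoc lo (ℕtoℚ (gap k r)) (ℕtoℚ (gap k r))))

  sand-large : ∀ {r hist bs lo hi} x → size x ℚ.≤ u → size x ℚ.≤ hi →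
    place k bs (A hist x) (size x) ≡ bs ++ [ (size x , 1) ] →
    Sand r (hist ++ [ x ]) (bs ++ [ (size x , 1) ]) lo (size x) → Sand (suc r) hist bs lo hi
  sand-large {hist = hist} {bs} x x≤u x≤hi eq S = record
    { items = x ∷ items ; smalls = smalls ; larges = x ∷ larges ; lo′ = lo′ ; hi′ = hi′ ; bins = bins
    ; items-≡ = cong suc items-≡ ; items-↭ = ↭-trans (prep x items-↭) (↭-sym (Perm.shift x smalls larges))
    ; items-≤ = x≤u ∷ items-≤ ; smalls-≤ = smalls-≤ ; larges-≥ = hi≥ ∷ larges-≥
    ; lo≤ = lo≤ ; hi≥ = ℚ.≤-trans hi≥ x≤hi ; gap-≤ = gap-≤ ; bins-≥ = bins-≥ ; bins-≤k = bins-≤k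
    ; bins-≡ = trans bins-≡ (trans (cong (ℕ._+ length larges) (List.length-++ bs))
                                   (ℕ.+-assoc (length bs) 1 (length larges)))
    ; run = λ ys → trans (cong (λ z → runFrom k A (hist ++ [ x ]) z (items ++ ys)) eq)
                     (trans (run ys) (cong (λ h → runFrom k A h bins ys) (List.++-assoc hist [ x ] items))) }
    where open Sand S

  sand-small : ∀ {r hist bs bs′ lo hi} x → size x ℚ.≤ u → lo ℚ.≤ size x → length bs′ ≡ length bs →
    place k bs (A hist x) (size x) ≡ bs′ →
    Sand r (hist ++ [ x ]) bs′ (size x) hi → Sand (suc r) hist bs lo hi
  sand-small {hist = hist} x x≤u lo≤x len eq S = record
    { items = x ∷ items ; smalls = x ∷ smalls ; larges = larges ; lo′ = lo′ ; hi′ = hi′ ; bins = bins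
    ; items-≡ = cong suc items-≡ ; items-↭ = prep x items-↭
    ; items-≤ = x≤u ∷ items-≤ ; smalls-≤ = lo≤ ∷ smalls-≤ ; larges-≥ = larges-≥
    ; lo≤ = ℚ.≤-trans lo≤x lo≤ ; hi≥ = hi≥ ; gap-≤ = gap-≤ ; bins-≥ = bins-≥ ; bins-≤k = bins-≤k
    ; bins-≡ = trans bins-≡ (cong (ℕ._+ length larges) len)
    ; run = λ ys → trans (cong (λ z → runFrom k A (hist ++ [ x ]) z (items ++ ys)) eq)
                     (trans (run ys) (cong (λ h → runFrom k A h bins ys) (List.++-assoc hist [ x ] items))) }
    where open Sand S

  Sandable : ℕ → Set
  Sandable r = ∀ hist bs {lo hi} → 0ℚ < lo → scale lo r ℚ.≤ hi → hi ℚ.≤ u →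
    All (λ b → hi ℚ.≤ proj₁ b) bs → All (λ b → proj₂ b ≤ k) bs → Sand r hist bs lo hi

  -- An item that opens a bin becomes the new upper end of the interval, any other the new lower
  -- end. `bs′` and its equation are separate arguments so that matching on `Placed` need not unify
  -- with a call of `place`.
  sand-suc : ∀ {r} → Sandable r → ∀ hist bs {lo hi} x → 0ℚ < lo → lo ℚ.≤ size x → scale lo r ℚ.≤ size x →
    size x ℚ.≤ hi → scale (size x) r ℚ.≤ hi → hi ℚ.≤ u →
    All (λ b → hi ℚ.≤ proj₁ b) bs → All (λ b → proj₂ b ≤ k) bs →
    ∀ bs′ → place k bs (A hist x) (size x) ≡ bs′ → Placed k bs (size x) bs′ → Sand (suc r) hist bs lo hi
  sand-suc rec hist bs x 0<lo lo≤x scale≤x x≤hi scale≤hi hi≤u bs-≥ bs-≤k _ eq opened =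
    sand-large x (ℚ.≤-trans x≤hi hi≤u) x≤hi eq
      (rec (hist ++ [ x ]) (bs ++ [ (size x , 1) ]) 0<lo scale≤x (ℚ.≤-trans x≤hi hi≤u)
        (All.++⁺ (All.map (ℚ.≤-trans x≤hi) bs-≥) (ℚ.≤-refl ∷ []))
        (All.++⁺ bs-≤k (1≤k ∷ [])))
  sand-suc rec hist bs x 0<lo lo≤x scale≤x x≤hi scale≤hi hi≤u bs-≥ bs-≤k _ eq (added pre l c post refl l+s≤1 c<k)
    with All.++⁻ pre bs-≥ | All.++⁻ pre bs-≤k
  ... | pre-≥ , l-≥ ∷ post-≥ | pre-≤ , _ ∷ post-≤ = sand-small x (ℚ.≤-trans x≤hi hi≤u) lo≤x
      (trans (List.length-++ pre) (sym (List.length-++ pre))) eq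
      (rec (hist ++ [ x ]) (pre ++ (l + size x , suc c) ∷ post) (ℚ.<-≤-trans 0<lo lo≤x) scale≤hi hi≤u
        (All.++⁺ pre-≥ (ℚ.≤-trans l-≥ (subst (ℚ._≤ l + size x) (ℚ.+-identityʳ l)
          (ℚ.+-monoʳ-≤ l (ℚ.<⇒≤ (proj₁ (proj₂ x))))) ∷ post-≥))
        (All.++⁺ pre-≤ (c<k ∷ post-≤)))

  sand : ∀ r → Sandable r
  sand zero hist bs {lo} {hi} 0<lo lo≤hi hi≤u bs-≥ bs-≤k = record
    { items = [] ; smalls = [] ; larges = [] ; lo′ = lo ; hi′ = hi ; bins = bs
    ; items-≡ = refl ; items-↭ = ↭-refl ; items-≤ = [] ; smalls-≤ = [] ; larges-≥ = []
    ; lo≤ = ℚ.≤-refl ; hi≥ = ℚ.≤-refl ; gap-≤ = lo≤hi ; bins-≥ = bs-≥ ; bins-≤k = bs-≤k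
    ; bins-≡ = sym (ℕ.+-identityʳ _)
    ; run = λ ys → cong (λ h → runFrom k A h bs ys) (sym (List.++-identityʳ hist)) }
  sand (suc r) hist bs {lo} {hi} 0<lo lo≤hi hi≤u bs-≥ bs-≤k =
    sand-suc (sand r) hist bs x 0<lo (lo≤scale r 0<lo) ℚ.≤-refl scale≤hi scale²≤hi hi≤u bs-≥ bs-≤k
      (place k bs (A hist x) (size x)) refl (placed k bs (A hist x) (size x))
    where
    0<scale : 0ℚ < scale lo r
    0<scale = ℚ.<-≤-trans 0<lo (lo≤scale r 0<lo)
    scale²≤hi : scale (scale lo r) r ℚ.≤ hi
    scale²≤hi = subst (ℚ._≤ hi) (scale-suc lo r) lo≤hi
    scale≤hi : scale lo r ℚ.≤ hi
    scale≤hi = ℚ.≤-trans (lo≤scale r 0<scale) scale²≤hi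
    -- A multiplicative midpoint: `lo` lies a factor `gap k r` below it and `hi` at least that
    -- factor above it.
    x : Item
    x = scale lo r , 0<scale , ℚ.≤-trans scale≤hi (ℚ.≤-trans hi≤u u≤1)

  Blocks : ℚ → BinState → Set
  Blocks s b = 1ℚ < proj₁ b + s

  -- Every copy opens a bin, and that bin rejects all later copies because two of them exceed 1.
  length-blocked : ∀ T hist bs x → All (Blocks (size x)) bs → 1ℚ < size x + size x →
    length (runFrom k A hist bs (replicate T x)) ≡ length bs ℕ.+ T
  length-blocked zero    hist bs x _ _ = sym (ℕ.+-identityʳ _)
  length-blocked (suc T) hist bs x blocked big = next _ refl (placed k bs (A hist x) (size x))
    where
    next : ∀ bs′ → place k bs (A hist x) (size x) ≡ bs′ → Placed k bs (size x) bs′ →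
      length (runFrom k A (hist ++ [ x ]) (place k bs (A hist x) (size x)) (replicate T x)) ≡ length bs ℕ.+ suc T
    next _ eq opened rewrite eq = trans
      (length-blocked T (hist ++ [ x ]) (bs ++ [ (size x , 1) ]) x (All.++⁺ blocked (big ∷ [])) big)
      (trans (cong (ℕ._+ T) (List.length-++ bs)) (ℕ.+-assoc (length bs) 1 T))
    next _ eq (added pre l c post refl l+s≤1 _) with All.++⁻ʳ pre blocked
    ... | l+s>1 ∷ _ = contradiction (ℚ.<-≤-trans l+s>1 l+s≤1) (ℚ.<-irrefl refl)

-- Optimal packings of the adversary's inputs.

0≤load : ∀ b → 0ℚ ℚ.≤ load b
0≤load []                  = ℚ.≤-refl
0≤load ((_ , 0<s , _) ∷ b) = 0≤p+q (ℚ.<⇒≤ 0<s) (0≤load b)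

size≤load : ∀ b → All (λ x → size x ℚ.≤ load b) b
size≤load []                      = []
size≤load (x@(s , 0<s , _) ∷ b) =
  subst (ℚ._≤ s + load b) (ℚ.+-identityʳ s) (ℚ.+-monoʳ-≤ s (0≤load b)) ∷
  All.map (λ {y} y≤ → ℚ.≤-trans y≤ (subst (ℚ._≤ s + load b) (ℚ.+-identityˡ (load b)) (ℚ.+-monoˡ-≤ (load b) (ℚ.<⇒≤ 0<s))))
    (size≤load b)

load-uniform : ∀ {b n v} → 0ℚ ℚ.≤ v → length b ≤ n → All (λ x → size x ℚ.≤ v) b → load b ℚ.≤ ℕtoℚ n ℚ.* v
load-uniform {v = v} 0≤v len all = ℚ.≤-trans (total-≤ size all)
  (ℚ.*-monoʳ-≤-nonNeg v {{ℚ.nonNegative 0≤v}} (ℕtoℚ-mono-≤ len))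

load-↭ : ∀ {b b′} → b ↭ b′ → load b ≡ load b′
load-↭ = total-↭ size

module Weight (k : ℕ) (1≤k : 1 ≤ k) (s h : ℚ) (h≤s : h ℚ.≤ s) (1<h+s : 1ℚ < h + s) where

  -- `s` will be the size of the big items and `h` a lower bound for the larger tiny ones: a big
  -- item is worth a whole bin, a larger tiny item one of `k` places.
  weight : Item → ℕ
  weight x with s ℚ.≤? size x
  ... | yes _ = k
  ... | no  _ with h ℚ.≤? size x
  ...   | yes _ = 1
  ...   | no  _ = 0

  weight≤k : ∀ x → weight x ≤ k
  weight≤k x with s ℚ.≤? size x
  ... | yes _ = ℕ.≤-refl
  ... | no  _ with h ℚ.≤? size x
  ...   | yes _ = 1≤k
  ...   | no  _ = z≤n

  weight≤1 : ∀ {x} → ¬ (s ℚ.≤ size x) → weight x ≤ 1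
  weight≤1 {x} s≰x with s ℚ.≤? size x
  ... | yes s≤x = contradiction s≤x s≰x
  ... | no  _ with h ℚ.≤? size x
  ...   | yes _ = ℕ.≤-refl
  ...   | no  _ = z≤n

  weight≤0 : ∀ {x} → size x < h → weight x ≤ 0
  weight≤0 {x} x<h with s ℚ.≤? size x
  ... | yes s≤x = contradiction (ℚ.<-≤-trans x<h (ℚ.≤-trans h≤s s≤x)) (ℚ.<-irrefl refl)
  ... | no  _ with h ℚ.≤? size x
  ...   | yes h≤x = contradiction (ℚ.<-≤-trans x<h h≤x) (ℚ.<-irrefl refl)
  ...   | no  _ = z≤n

  1≤weight : ∀ {x} → h ℚ.≤ size x → 1 ≤ weight x
  1≤weight {x} h≤x with s ℚ.≤? size x
  ... | yes _ = 1≤k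
  ... | no  _ with h ℚ.≤? size x
  ...   | yes _ = ℕ.≤-refl
  ...   | no h≰x = contradiction h≤x h≰x

  k≤weight : ∀ {x} → s ℚ.≤ size x → k ≤ weight x
  k≤weight {x} s≤x with s ℚ.≤? size x
  ... | yes _ = ℕ.≤-refl
  ... | no s≰x = contradiction s≤x s≰x

  -- A big item leaves less than `h` for the rest of its bin, where all other items then weigh 0.
  -- Without a big item, at most `k` items weigh at most 1 each.
  bin-weight : ∀ b → load b ℚ.≤ 1ℚ → length b ≤ k → sumOf weight b ≤ k
  bin-weight b b≤1 len with any? (λ x → s ℚ.≤? size x) b
  ... | no ¬big = ℕ.≤-trans (sumOf-≤ weight (All.map (λ {x} → weight≤1 {x}) (All.¬Any⇒All¬ b ¬big)))
                    (subst (_≤ k) (sym (ℕ.*-identityʳ (length b))) len)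
  ... | yes big with modify-↭ id big
  ...   | x , rest , s≤x , b↭ , _ = subst (_≤ k) (sym (sumOf-↭ weight b↭))
    (subst (weight x ℕ.+ sumOf weight rest ≤_) (ℕ.+-identityʳ k)
      (ℕ.+-mono-≤ (weight≤k x) (subst (sumOf weight rest ≤_) (ℕ.*-zeroʳ (length rest))
        (sumOf-≤ weight (All.map (λ {y} y≤ → weight≤0 {y} (ℚ.≤-<-trans y≤ rest<h)) (size≤load rest))))))
    where
    rest<h : load rest < h
    rest<h = 0<q-p⇒p<q (0<p+q (p<q⇒0<q-p 1<h+s) (0≤p+q (p≤q⇒0≤q-p s≤x)
               (p≤q⇒0≤q-p (subst (ℚ._≤ 1ℚ) (load-↭ b↭) b≤1))))
      (solve 4 (λ h s x r → h :- r := (h :+ s :- con 1ℚ) :+ ((x :- s) :+ (con 1ℚ :- (x :+ r)))) refl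
        h s (size x) (load rest))
      where open ℚSolver.+-*-Solver

  sumOf-replicate : ∀ n x → s ℚ.≤ size x → n ℕ.* k ≤ sumOf weight (replicate n x)
  sumOf-replicate zero    x s≤x = z≤n
  sumOf-replicate (suc n) x s≤x = ℕ.+-mono-≤ (k≤weight {x} s≤x) (sumOf-replicate n x s≤x)

  length≤sumOf : ∀ {xs} → All (λ x → h ℚ.≤ size x) xs → length xs ≤ sumOf weight xs
  length≤sumOf []                 = z≤n
  length≤sumOf {x ∷ _} (h≤x ∷ hs) = ℕ.+-mono-≤ (1≤weight {x} h≤x) (length≤sumOf hs)

concat-map-∷ : ∀ {A : Set} (x : A) bs → concat (map (x ∷_) bs) ↭ replicate (length bs) x ++ concat bs
concat-map-∷ x []       = ↭-refl
concat-map-∷ x (b ∷ bs) = prep x (↭-trans (Perm.++⁺ˡ b (concat-map-∷ x bs)) (↭-trans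
  (↭-reflexive (sym (List.++-assoc b (replicate (length bs) x) (concat bs))))
  (↭-trans (Perm.++⁺ʳ (concat bs) (Perm.++-comm b (replicate (length bs) x)))
    (↭-reflexive (List.++-assoc (replicate (length bs) x) b (concat bs))))))

IsOpt-uniform : ∀ {k u xs} T → 1 ≤ k → 0ℚ ℚ.≤ u → ℕtoℚ k ℚ.* u ℚ.≤ 1ℚ → length xs ≡ T ℕ.* k →
  All (λ x → size x ℚ.≤ u) xs → IsOpt k xs T
IsOpt-uniform {k} {u} {xs} T 1≤k 0≤u ku≤1 len xs≤u with chunk k T xs (ℕ.≤-reflexive len) xs≤u
... | bins , T≡ , concat≡ , ok =
  (bins , T≡ , ↭-reflexive concat≡ , All.map (λ (l , a) → ℚ.≤-trans (load-uniform 0≤u l a) ku≤1 , l) ok) ,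
  λ m′ P → ℕ.*-cancelʳ-≤ T m′ k {{ℕ.>-nonZero 1≤k}} (subst (_≤ m′ ℕ.* k) len (Packable-length P))

module BigItems (κ : ℕ) (u lo hi : ℚ) (xs smalls larges : List Item) (T : ℕ) (big : Item)
  (0≤lo : 0ℚ ℚ.≤ lo) (0≤u : 0ℚ ℚ.≤ u) (ku≤1 : ℕtoℚ (suc κ) ℚ.* u ℚ.≤ 1ℚ)
  (xs↭ : xs ↭ smalls ++ larges)
  (smalls≤ : All (λ x → size x ℚ.≤ lo) smalls)
  (larges≥ : All (λ x → hi ℚ.≤ size x) larges)
  (larges≤ : All (λ x → size x ℚ.≤ u) larges)
  (few : length smalls ≤ T ℕ.* κ)
  (big+smalls : size big + ℕtoℚ κ ℚ.* lo ≡ 1ℚ)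
  (hi≤big : hi ℚ.≤ size big) (1<hi+big : 1ℚ < hi + size big) where

  k = suc κ
  open Weight k (s≤s z≤n) (size big) hi hi≤big 1<hi+big

  -- The hypotheses make `q` the quotient `length larges / k` rounded up. Each big item is packed
  -- with at most `κ` smalls, and the larges go `k` to a bin. The total weight, at least
  -- `T * k + length larges`, exceeds `(T + q - 1) * k`, so no packing is smaller.
  IsOpt-big : ∀ q → length larges ≤ q ℕ.* k → q ℕ.* k ℕ.< length larges ℕ.+ k →
    IsOpt k (xs ++ replicate T big) (T ℕ.+ q)
  IsOpt-big q enough tight
    with chunk κ T smalls few smalls≤ | chunk k q larges enough larges≤
  ... | cs , refl , cs≡ , cs-ok | ds , refl , ds≡ , ds-ok =
    (map (big ∷_) cs ++ ds ,
     trans (List.length-++ (map (big ∷_) cs)) (cong (ℕ._+ length ds) (List.length-map (big ∷_) cs)) ,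
     perm ,
     All.++⁺ (All.map⁺ (All.map with-big cs-ok))
             (All.map (λ (l , a) → ℚ.≤-trans (load-uniform 0≤u l a) ku≤1 , l) ds-ok)) ,
    minimal
    where
    bigs = replicate (length cs) big
    with-big : ∀ {c} → length c ≤ κ × All (λ x → size x ℚ.≤ lo) c → load (big ∷ c) ℚ.≤ 1ℚ × length (big ∷ c) ≤ k
    with-big {c} (l , a) = subst (size big + load c ℚ.≤_) big+smalls (ℚ.+-monoʳ-≤ (size big) (load-uniform 0≤lo l a)) , s≤s l
    perm : concat (map (big ∷_) cs ++ ds) ↭ xs ++ bigs
    perm = ↭-trans (↭-reflexive (sym (List.concat-++ (map (big ∷_) cs) ds)))
      (↭-trans (Perm.++⁺ (concat-map-∷ big cs) (↭-reflexive ds≡))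
      (↭-trans (↭-reflexive (trans (cong (λ z → (bigs ++ z) ++ larges) cs≡) (List.++-assoc bigs smalls larges)))
      (↭-trans (Perm.++⁺ˡ bigs (↭-sym xs↭)) (Perm.++-comm bigs xs))))
    minimal : ∀ m′ → Packable k (xs ++ bigs) m′ → length cs ℕ.+ length ds ≤ m′
    minimal m′ P = ℕ.≤-pred (ℕ.*-cancelʳ-< k _ _ (begin-strict
      (length cs ℕ.+ length ds) ℕ.* k                         ≡⟨ ℕ.*-distribʳ-+ k (length cs) (length ds) ⟩
      length cs ℕ.* k ℕ.+ length ds ℕ.* k                     <⟨ ℕ.+-monoʳ-< (length cs ℕ.* k) tight ⟩
      length cs ℕ.* k ℕ.+ (length larges ℕ.+ k)               ≤⟨ ℕ.+-mono-≤ (sumOf-replicate (length cs) big ℚ.≤-refl)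
                                                                   (ℕ.+-monoˡ-≤ k (length≤sumOf larges≥)) ⟩
      sumOf weight bigs ℕ.+ (sumOf weight larges ℕ.+ k)       ≤⟨ ℕ.+-monoʳ-≤ (sumOf weight bigs) (ℕ.+-monoˡ-≤ k larges≤xs) ⟩
      sumOf weight bigs ℕ.+ (sumOf weight xs ℕ.+ k)           ≡⟨ ℕ.+-assoc (sumOf weight bigs) _ k ⟨
      sumOf weight bigs ℕ.+ sumOf weight xs ℕ.+ k             ≡⟨ cong (ℕ._+ k) (ℕ.+-comm (sumOf weight bigs) _) ⟩
      sumOf weight xs ℕ.+ sumOf weight bigs ℕ.+ k             ≡⟨ cong (ℕ._+ k) (sumOf-++ weight xs bigs) ⟨
      sumOf weight (xs ++ bigs) ℕ.+ k                         ≤⟨ ℕ.+-monoˡ-≤ k (Packable-weight weight bin-weight P) ⟩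
      m′ ℕ.* k ℕ.+ k                                          ≡⟨ ℕ.+-comm (m′ ℕ.* k) k ⟩
      suc m′ ℕ.* k                                            ∎))
      where
      open ℕ.≤-Reasoning
      larges≤xs : sumOf weight larges ≤ sumOf weight xs
      larges≤xs = subst (sumOf weight larges ≤_) (sym (trans (sumOf-↭ weight xs↭) (sumOf-++ weight smalls larges)))
        (ℕ.m≤n+m _ (sumOf weight smalls))

ceiling : ∀ a κ → ∃[ q ] a ≤ q ℕ.* suc κ × q ℕ.* suc κ ℕ.< a ℕ.+ suc κ
ceiling a κ = q , ℕ.+-cancelʳ-≤ κ a (q ℕ.* suc κ) le , lt
  where
  q = (a ℕ.+ κ) ℕ./ suc κ
  eq : a ℕ.+ κ ≡ (a ℕ.+ κ) ℕ.% suc κ ℕ.+ q ℕ.* suc κ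
  eq = ℕ.m≡m%n+[m/n]*n (a ℕ.+ κ) (suc κ)
  le : a ℕ.+ κ ≤ q ℕ.* suc κ ℕ.+ κ
  le = subst₂ _≤_ (sym eq) (ℕ.+-comm κ _) (ℕ.+-monoˡ-≤ (q ℕ.* suc κ) (ℕ.≤-pred (ℕ.m%n<n (a ℕ.+ κ) (suc κ))))
  lt : q ℕ.* suc κ ℕ.< a ℕ.+ suc κ
  lt = subst (q ℕ.* suc κ ℕ.<_) (sym (ℕ.+-suc a κ)) (s≤s (subst (q ℕ.* suc κ ≤_) (sym eq) (ℕ.m≤n+m _ _)))

module BigSize (κ : ℕ) (u lo hi : ℚ) (0<lo : 0ℚ < lo) (gap≤ : lo ℚ.* ℕtoℚ (suc κ) ℚ.≤ hi)
  (hi≤u : hi ℚ.≤ u) (2u≤1 : u + u ℚ.≤ 1ℚ) where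

  open ℚSolver.+-*-Solver

  κlo = ℕtoℚ κ ℚ.* lo

  -- The largest size that leaves room for `κ` items of size `lo`. As `hi` is at least
  -- `(κ + 1) * lo`, an item of size `hi` next to it overflows the bin by at least `lo`.
  bigSize : ℚ
  bigSize = 1ℚ - κlo

  0≤κlo : 0ℚ ℚ.≤ κlo
  0≤κlo = subst (ℚ._≤ κlo) (ℚ.*-zeroˡ lo)
    (ℚ.*-monoʳ-≤-nonNeg lo {{ℚ.nonNegative (ℚ.<⇒≤ 0<lo)}} (0≤ℕtoℚ κ))

  lo+κlo≤hi : lo + κlo ℚ.≤ hi
  lo+κlo≤hi = subst (ℚ._≤ hi)
    (trans (cong (lo ℚ.*_) (ℕtoℚ-homo-+ 1 κ))
           (solve 2 (λ l κ → l :* (con 1ℚ :+ κ) := l :+ κ :* l) refl lo (ℕtoℚ κ)))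
    gap≤

  slack₁ = p≤q⇒0≤q-p lo+κlo≤hi
  slack₂ = p≤q⇒0≤q-p hi≤u
  slack₃ = p≤q⇒0≤q-p 2u≤1

  big+smalls : bigSize + κlo ≡ 1ℚ
  big+smalls = solve 1 (λ x → con 1ℚ :- x :+ x := con 1ℚ) refl κlo

  1<hi+big : 1ℚ < hi + bigSize
  1<hi+big = 0<q-p⇒p<q (0<p+q 0<lo slack₁)
    (solve 3 (λ h x l → h :+ (con 1ℚ :- x) :- con 1ℚ := l :+ (h :- (l :+ x))) refl hi κlo lo)

  hi≤big : hi ℚ.≤ bigSize
  hi≤big = 0≤q-p⇒p≤q (0≤p+q (0≤p+q slack₁ (0≤p+q slack₂ slack₂)) (0≤p+q slack₃ (ℚ.<⇒≤ 0<lo)))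
    (solve 4 (λ h x l u → con 1ℚ :- x :- h :=
        (h :- (l :+ x)) :+ ((u :- h) :+ (u :- h)) :+ ((con 1ℚ :- (u :+ u)) :+ l)) refl hi κlo lo u)

  0<hi : 0ℚ < hi
  0<hi = ℚ.<-≤-trans (0<p+q 0<lo 0≤κlo) lo+κlo≤hi

  1<big+big : 1ℚ < bigSize + bigSize
  1<big+big = ℚ.<-≤-trans 1<hi+big (ℚ.+-monoˡ-≤ bigSize hi≤big)

  bigItem : Item
  bigItem = bigSize , ℚ.<-≤-trans 0<hi hi≤big , 0≤q-p⇒p≤q 0≤κlo (solve 1 (λ x → con 1ℚ :- (con 1ℚ :- x) := x) refl κlo)

-- The lower bound 2.

ratio-many : ∀ ε T a → 0ℚ < ε → 1 ≤ T → T ℕ.+ T ≤ a → (2ℚ - ε) ℚ.* ℕtoℚ T < ℕtoℚ a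
ratio-many ε T a 0<ε 1≤T 2T≤a = 0<q-p⇒p<q (ℚ.+-mono-≤-< (p≤q⇒0≤q-p (ℕtoℚ-mono-≤ 2T≤a)) 0<εT)
  (trans (solve 3 (λ ε t a → a :- (con 2ℚ :- ε) :* t := (a :- (t :+ t)) :+ ε :* t) refl ε (ℕtoℚ T) (ℕtoℚ a))
         (cong (λ z → ℕtoℚ a - z + ε ℚ.* ℕtoℚ T) (sym (ℕtoℚ-homo-+ T T))))
  where
  open ℚSolver.+-*-Solver
  0<εT : 0ℚ < ε ℚ.* ℕtoℚ T
  0<εT = subst (_< ε ℚ.* ℕtoℚ T) (ℚ.*-zeroʳ ε)
    (ℚ.*-monoʳ-<-pos ε {{ℚ.positive 0<ε}} (ℚ.<-≤-trans (ℚ.positive⁻¹ 1ℚ) (ℕtoℚ-mono-≤ 1≤T)))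

-- The algorithm uses at least `2 T` bins, and twice the optimum is at most `2 T + 4 j`; the excess
-- `4 j` is outweighed by `ε * T = ε * k * j`.
ratio-few : ∀ ε k j T a q → T ≡ k ℕ.* j → 0ℚ < ε → ℕtoℚ 4 < ε ℚ.* ℕtoℚ k → 1 ≤ j → T ≤ a → q ≤ 2 ℕ.* j →
  (2ℚ - ε) ℚ.* ℕtoℚ (T ℕ.+ q) < ℕtoℚ (a ℕ.+ T)
ratio-few ε k j _ a q refl 0<ε 4<εk 1≤j T≤a q≤2j
  rewrite ℕtoℚ-homo-+ (k ℕ.* j) q | ℕtoℚ-homo-+ a (k ℕ.* j) | ℕtoℚ-homo-* k j
  = 0<q-p⇒p<q (0<p+q 0<main (0≤p+q slack-a (0≤p+q (0≤p+q slack-q slack-q) 0≤εq)))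
      (solve 5 (λ ε k j a q → (a :+ k :* j) :- (con 2ℚ :- ε) :* (k :* j :+ q) :=
          (ε :* k :- con (ℕtoℚ 4)) :* j :+ ((a :- k :* j) :+ (((con 2ℚ :* j :- q) :+ (con 2ℚ :* j :- q)) :+ ε :* q)))
        refl ε (ℕtoℚ k) (ℕtoℚ j) (ℕtoℚ a) (ℕtoℚ q))
  where
  open ℚSolver.+-*-Solver
  slack-a : 0ℚ ℚ.≤ ℕtoℚ a - ℕtoℚ k ℚ.* ℕtoℚ j
  slack-a = subst (λ z → 0ℚ ℚ.≤ ℕtoℚ a - z) (ℕtoℚ-homo-* k j) (p≤q⇒0≤q-p (ℕtoℚ-mono-≤ T≤a))
  slack-q : 0ℚ ℚ.≤ 2ℚ ℚ.* ℕtoℚ j - ℕtoℚ q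
  slack-q = subst (λ z → 0ℚ ℚ.≤ z - ℕtoℚ q) (ℕtoℚ-homo-* 2 j) (p≤q⇒0≤q-p (ℕtoℚ-mono-≤ q≤2j))
  0≤εq : 0ℚ ℚ.≤ ε ℚ.* ℕtoℚ q
  0≤εq = subst (ℚ._≤ ε ℚ.* ℕtoℚ q) (ℚ.*-zeroʳ ε)
    (ℚ.*-monoˡ-≤-nonNeg ε {{ℚ.nonNegative (ℚ.<⇒≤ 0<ε)}} (0≤ℕtoℚ q))
  pos-j : ℚ.Positive (ℕtoℚ j)
  pos-j = ℚ.positive (ℚ.<-≤-trans (ℚ.positive⁻¹ 1ℚ) (ℕtoℚ-mono-≤ 1≤j))
  0<main : 0ℚ < (ε ℚ.* ℕtoℚ k - ℕtoℚ 4) ℚ.* ℕtoℚ j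
  0<main = subst (_< (ε ℚ.* ℕtoℚ k - ℕtoℚ 4) ℚ.* ℕtoℚ j) (ℚ.*-zeroˡ (ℕtoℚ j)) (ℚ.*-monoˡ-<-pos (ℕtoℚ j) {{pos-j}} (p<q⇒0<q-p 4<εk))

-- Tiny sizes are at most `u = 1 / (2 k)`, so any `k` of them fit in a bin and `2 u ≤ 1`. The
-- parameter `j` scales the instance to force a large optimum.
module Attack (κ j T : ℕ) (T≡ : T ≡ suc κ ℕ.* j) (1≤j : 1 ≤ j) (ε : ℚ) (0<ε : 0ℚ < ε) (4<εk : ℕtoℚ 4 < ε ℚ.* ℕtoℚ (suc κ))
  (A : OnlineAlg) (u : ℚ) (0<u : 0ℚ < u) (2ku≡1 : u ℚ.* ℕtoℚ (suc κ ℕ.+ suc κ) ≡ 1ℚ) where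

  k = suc κ

  ku = ℕtoℚ k ℚ.* u

  ku+ku≡1 : ku + ku ≡ 1ℚ
  ku+ku≡1 = trans (trans (sym (ℚ.*-distribʳ-+ u (ℕtoℚ k) (ℕtoℚ k))) (ℚ.*-comm (ℕtoℚ k + ℕtoℚ k) u))
    (trans (cong (u ℚ.*_) (sym (ℕtoℚ-homo-+ k k))) 2ku≡1)

  u≤ku : u ℚ.≤ ku
  u≤ku = subst (ℚ._≤ ku) (ℚ.*-identityˡ u)
    (ℚ.*-monoʳ-≤-nonNeg u {{ℚ.nonNegative (ℚ.<⇒≤ 0<u)}} (ℕtoℚ-mono-≤ {1} {k} (s≤s z≤n)))

  ku≤1 : ku ℚ.≤ 1ℚ
  ku≤1 = subst₂ ℚ._≤_ (ℚ.+-identityʳ ku) ku+ku≡1 (ℚ.+-monoʳ-≤ ku (ℚ.≤-trans (ℚ.<⇒≤ 0<u) u≤ku))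

  2u≤1 : u + u ℚ.≤ 1ℚ
  2u≤1 = subst (u + u ℚ.≤_) ku+ku≡1 (ℚ.+-mono-≤ u≤ku u≤ku)

  open Adversary k A (s≤s z≤n) u (ℚ.≤-trans u≤ku ku≤1)

  1≤T : 1 ≤ T
  1≤T = subst (1 ≤_) (sym T≡) (ℕ.*-mono-≤ {1} {k} (s≤s z≤n) 1≤j)

  j≤T : j ≤ T
  j≤T = subst (j ≤_) (sym T≡) (ℕ.m≤m+n j (κ ℕ.* j))

  Exceeded : Set
  Exceeded = ∃[ L ] ∃[ m ] IsOpt k L m × j ≤ m × 1 ≤ m × (2ℚ - ε) ℚ.* ℕtoℚ m < ℕtoℚ (binsUsed k A L)

  module _ {N lo} (N≡ : N ≡ T ℕ.* k) (0<lo : 0ℚ < lo) (S : Sand N [] [] lo u) where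

    open Sand S

    a = length larges

    exceeds-many : T ℕ.+ T ≤ a → Exceeded
    exceeds-many many =
      items , T , IsOpt-uniform T (s≤s z≤n) (ℚ.<⇒≤ 0<u) ku≤1 (trans items-≡ N≡) items-≤ , j≤T , 1≤T ,
      subst (λ n → (2ℚ - ε) ℚ.* ℕtoℚ T < ℕtoℚ n) (sym used) (ratio-many ε T a 0<ε 1≤T many)
      where
      used : binsUsed k A items ≡ a
      used = trans (cong (binsUsed k A) (sym (List.++-identityʳ items))) (trans (cong length (run [])) bins-≡)

    counts : sumOf proj₂ bins ≡ T ℕ.* k
    counts = trans (cong (sumOf proj₂) (sym (run [])))
      (trans (sumOf-runFrom k A [] [] (items ++ [])) (trans (cong length (List.++-identityʳ items)) (trans items-≡ N≡)))

    -- The `T * k` tiny items lie in bins of at most `k` items, and there are as many bins as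
    -- `larges`.
    T≤a : T ≤ a
    T≤a = ℕ.*-cancelʳ-≤ T a k (subst₂ _≤_ counts (cong (ℕ._* k) bins-≡) (sumOf-≤ proj₂ bins-≤k))

    smalls-few : length smalls ≤ T ℕ.* κ
    smalls-few = ℕ.+-cancelʳ-≤ T _ _ (begin
      length smalls ℕ.+ T               ≤⟨ ℕ.+-monoʳ-≤ (length smalls) T≤a ⟩
      length smalls ℕ.+ a               ≡⟨ List.length-++ smalls ⟨
      length (smalls ++ larges)         ≡⟨ Perm.↭-length items-↭ ⟨
      length items                      ≡⟨ trans items-≡ N≡ ⟩
      T ℕ.* k                           ≡⟨ ℕ.*-suc T κ ⟩
      T ℕ.+ T ℕ.* κ                     ≡⟨ ℕ.+-comm T _ ⟩
      T ℕ.* κ ℕ.+ T                     ∎)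
      where open ℕ.≤-Reasoning

    0<lo′ : 0ℚ < lo′
    0<lo′ = ℚ.<-≤-trans 0<lo lo≤

    open BigSize κ u lo′ hi′ 0<lo′ gap-≤ hi≥ 2u≤1

    used-big : binsUsed k A (items ++ replicate T bigItem) ≡ a ℕ.+ T
    used-big = trans (cong length (run (replicate T bigItem))) (trans
      (length-blocked T items bins bigItem
        (All.map (λ hi≤ → ℚ.<-≤-trans 1<hi+big (ℚ.+-monoˡ-≤ bigSize hi≤)) bins-≥) 1<big+big)
      (cong (ℕ._+ T) bins-≡))

    exceeds-few : a ℕ.< T ℕ.+ T → ∃[ q ] a ≤ q ℕ.* k × q ℕ.* k ℕ.< a ℕ.+ k → Exceeded
    exceeds-few few (q , enough , tight) = items ++ replicate T bigItem , T ℕ.+ q ,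
      BigItems.IsOpt-big κ u lo′ hi′ items smalls larges T bigItem (ℚ.<⇒≤ 0<lo′) (ℚ.<⇒≤ 0<u) ku≤1 items-↭
        smalls-≤ larges-≥ (All.++⁻ʳ smalls (Perm.All-resp-↭ items-↭ items-≤)) smalls-few
        big+smalls hi≤big 1<hi+big q enough tight ,
      ℕ.≤-trans j≤T (ℕ.m≤m+n T q) , ℕ.≤-trans 1≤T (ℕ.m≤m+n T q) ,
      subst (λ n → (2ℚ - ε) ℚ.* ℕtoℚ (T ℕ.+ q) < ℕtoℚ n) (sym used-big)
        (ratio-few ε k j T a q T≡ 0<ε 4<εk 1≤j T≤a q≤2j)
      where
      eq : T ℕ.+ T ℕ.+ k ≡ suc (2 ℕ.* j) ℕ.* k
      eq = trans (cong (λ T → T ℕ.+ T ℕ.+ k) T≡)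
        (solve 2 (λ k j → k :* j :+ k :* j :+ k := (con 1 :+ con 2 :* j) :* k) refl k j)
        where open ℕSolver.+-*-Solver
      -- From `a < 2 T` and `q * k < a + k` follows `q * k < (2 j + 1) * k`.
      q≤2j : q ≤ 2 ℕ.* j
      q≤2j = ℕ.≤-pred (ℕ.*-cancelʳ-< k q (suc (2 ℕ.* j))
        (ℕ.<-trans tight (subst (a ℕ.+ k ℕ.<_) eq (ℕ.+-monoˡ-< k few))))

    exceeds : Exceeded
    exceeds = Sum.[ exceeds-many , (λ few → exceeds-few few (ceiling a κ)) ]′ (ℕ.≤-<-connex (T ℕ.+ T) a)

  attack : ∀ N → N ≡ T ℕ.* k → Exceeded
  attack N N≡ = start (divide u (gap k N) 0<u (1≤gap (s≤s z≤n) N))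
    where
    start : ∃[ lo ] 0ℚ < lo × lo ℚ.* ℕtoℚ (gap k N) ≡ u → Exceeded
    -- Starting at `u / gap k N` makes the interval just wide enough for `N` items.
    start (lo , 0<lo , lo≡) = exceeds N≡ 0<lo (sand N [] [] 0<lo (ℚ.≤-reflexive lo≡) ℚ.≤-refl [] [])

exceeds-asym : ∀ κ ε → 0ℚ < ε → ℕtoℚ 4 < ε ℚ.* ℕtoℚ (suc κ) → ∀ A → AsymRatioExceeds (suc κ) A (2ℚ - ε)
exceeds-asym κ ε 0<ε 4<εk A K = start (divide 1ℚ (suc κ ℕ.+ suc κ) (ℚ.positive⁻¹ 1ℚ) (s≤s z≤n))
  where
  -- Using `suc K` for `j` keeps the instance nonempty when `K` is 0.
  T = suc κ ℕ.* suc K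
  Goal : ℕ → Set
  Goal K = ∃[ L ] ∃[ m ] IsOpt (suc κ) L m × K ≤ m × 1 ≤ m × (2ℚ - ε) ℚ.* ℕtoℚ m < ℕtoℚ (binsUsed (suc κ) A L)
  weaken : Goal (suc K) → Goal K
  weaken (L , m , opt , K<m , rest) = L , m , opt , ℕ.<⇒≤ K<m , rest
  start : ∃[ u ] 0ℚ < u × u ℚ.* ℕtoℚ (suc κ ℕ.+ suc κ) ≡ 1ℚ → Goal K
  start (u , 0<u , 2ku≡1) =
    weaken (Attack.attack κ (suc K) T refl (s≤s z≤n) ε 0<ε 4<εk A u 0<u 2ku≡1 (T ℕ.* suc κ) refl)

asymRatio≥2 : ∀ ε → 0ℚ < ε → ∃[ k ] (2 ≤ k) × (∀ A → AsymRatioExceeds k A (2ℚ - ε))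
asymRatio≥2 ε 0<ε with archimedean ε 0<ε
-- From `ε * suc q ≥ 1`, the choice `k = 5 * suc q` gives `ε * k ≥ 5`, strictly above the 4 that the
-- attack must beat.
... | suc q , _ , 1≤εq = 5 ℕ.* suc q , ℕ.*-mono-≤ {2} {5} (s≤s (s≤s z≤n)) (s≤s z≤n) , exceeds-asym _ ε 0<ε 4<ε5q
  where
  open ℚSolver.+-*-Solver
  4<5 : ℕtoℚ 4 < ℕtoℚ 5 ℚ.* 1ℚ
  4<5 = ℚ.*<* (ℤ.+<+ (ℕ.n<1+n 4))
  4<ε5q : ℕtoℚ 4 < ε ℚ.* ℕtoℚ (5 ℕ.* suc q)
  4<ε5q = ℚ.<-≤-trans 4<5 (subst (ℕtoℚ 5 ℚ.* 1ℚ ℚ.≤_)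
    (trans (solve 2 (λ e q → con (ℕtoℚ 5) :* (e :* q) := e :* (con (ℕtoℚ 5) :* q)) refl ε (ℕtoℚ (suc q)))
           (cong (ε ℚ.*_) (sym (ℕtoℚ-homo-* 5 (suc q)))))
    (ℚ.*-monoˡ-≤-nonNeg (ℕtoℚ 5) 1≤εq))

theorem5 : (∀ (k : ℕ) → 2 ≤ k → ∀ (ε : ℚ) → 0ℚ < ε →
    ∃[ A ] AbsRatioAtMost k A (2ℚ + ε))
    × (∀ (k : ℕ) → 2 ≤ k → ∀ (ε : ℚ) → 0ℚ < ε →
    ∃[ A ] AsymRatioEventuallyAtMost k A (2ℚ + ε))
    × (∀ (ε : ℚ) → 0ℚ < ε →
    ∃[ k ] (2 ≤ k) × (∀ (A : OnlineAlg) → AbsRatioExceeds k A (2ℚ - ε)))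
    × (∀ (ε : ℚ) → 0ℚ < ε →
    ∃[ k ] (2 ≤ k) × (∀ (A : OnlineAlg) → AsymRatioExceeds k A (2ℚ - ε)))
theorem5 =
  absRatio≤2 ,
  -- An absolute upper bound is an asymptotic one with threshold 0, and an asymptotic lower bound
  -- taken at threshold 0 is an absolute one.
  (λ k 2≤k ε 0<ε → let A , bound = absRatio≤2 k 2≤k ε 0<ε in A , 0 , λ L m opt _ → bound L m opt) ,
  (λ ε 0<ε → let k , 2≤k , exceeds = asymRatio≥2 ε 0<ε in
     k , 2≤k , λ A → let L , m , opt , _ , 1≤m , ratio = exceeds A 0 in L , m , opt , 1≤m , ratio) ,
  asymRatio≥2
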